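{- Consider a SOCO problem with a one-dimensional decision space and a norm $\|\cdot\|$ on $\mathbb{R}$. Let $\theta\ge1$ and let $N$ be the norm on $\mathbb{R}$ with $N(1)=\theta\|1\|$ (i.e. $N(x)=\theta\|x\|$). Then the algorithm RBG($N$) attains $\alpha$-unfair competitive ratio $CR_1^\alpha$ at most $(1+\theta)/\min\{\theta,\alpha\}$ (for every $\alpha\ge1$) and regret $R'_0$ of $O(\max\{T/\theta,\theta\})$.
   Context: Setting: the decision space is a compact interval $F=[x_L,x_H]\subseteq\mathbb{R}^+$, $\|\cdot\|$ is a norm on $\mathbb{R}$, and the cost functions $c^t:F\to\mathbb{R}^+$ are convex with subgradients uniformly bounded over the sequence, and bounded above by a constant independent of $T$. An online (possibly randomized) algorithm produces $x^1,x^2,\dots\in F$ with $x^s$ depending only on $c^1,\dots,c^{s-1}$ and internal randomness. For $\alpha\ge0$ and lookahead $i$, $C_i^\alpha(A)=\mathbb{E}\big[\sum_{t=1}^T c^t(x^{t+i})+\alpha\|x^{t+i}-x^{t+i-1}\|\big]$ with initial action $x^i=0$; $C_i=C_i^1$. $OPT_s=\min_{x\in F}\sum_{t=1}^T c^t(x)$; $OPT_d^\alpha=\min_{x\in F^T}\sum_{t=1}^T c^t(x^t)+\alpha\|x^t-x^{t-1}\|$ with $x^0=0$. The regret $R'_0(A)$ is (at most) $\rho(T)$ if $C_0^1(A)-OPT_s\le\rho(T)$ for every cost sequence; the $\alpha$-unfair competitive ratio $CR_1^\alpha(A)$ is (at most) $\rho$ if $C_1(A)\le\rho\,OPT_d^\alpha+O(1)$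 for every cost sequence. Algorithm RBG($N$) (Randomly Biased Greedy): define the work function $w^0(x)=N(x)$ and $w^t(x)=\min_{y\in F}\{w^{t-1}(y)+c^t(y)+N(x-y)\}$ for $x\in F$; draw a single random number $r$ uniformly from $(-1,1)$; at each time step $t$, choose $x^t\in F$ minimizing $Y^t(x)=w^{t-1}(x)+rN(x)$. -}

module Defs where

open import Algebra.Structures using (IsCommutativeRing)
import Algebra.Construct.NaturalChoice.Max as Max
import Algebra.Construct.NaturalChoice.Min as Min
open import Data.List.Base using (List; []; _∷_; applyDownFrom)
open import Data.Nat.Base as ℕ using (ℕ; zero; suc)
open import Data.Product.Base using (∃; _×_)
open import Level using (0ℓ)
open import Relation.Binary.Bundles using (TotalOrder)
open import Relation.Binary.PropositionalEquality.Core using (_≡_; _≢_)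
import Relation.Binary.Construct.NonStrictToStrict as NonStrictToStrict
open import Relation.Binary.Structures using (IsTotalOrder)

-- The standard library has no real numbers.  Classically the axioms below
-- characterise ℝ up to isomorphism.
record RealField : Set₁ where
  infix  9 _⁻¹
  infix  8 -_
  infixl 7 _*_ _÷_
  infixl 6 _+_ _-_
  infix  4 _≤_
  field
    Carrier           : Set
    _+_ _*_           : Carrier → Carrier → Carrier
    -_ _⁻¹            : Carrier → Carrier
    0# 1#             : Carrier
    _≤_               : Carrier → Carrier → Set
    isCommutativeRing : IsCommutativeRing _≡_ _+_ _*_ -_ 0# 1#
    0≢1               : 0# ≢ 1#
    -- The value of 0# ⁻¹ is unspecified.
    *-inverseʳ        : ∀ x → x ≢ 0# → x * x ⁻¹ ≡ 1#
    isTotalOrder      : IsTotalOrder _≡_ _≤_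
    +-monoʳ-≤         : ∀ x {y z} → y ≤ z → x + y ≤ x + z
    *-nonNegative     : ∀ {x y} → 0# ≤ x → 0# ≤ y → 0# ≤ x * y
    supremum          : (P : Carrier → Set) → ∃ P → (∃ λ b → ∀ x → P x → x ≤ b) →
                        ∃ λ s → (∀ x → P x → x ≤ s) ×
                                (∀ b → (∀ x → P x → x ≤ b) → s ≤ b)

  totalOrder : TotalOrder 0ℓ 0ℓ 0ℓ
  totalOrder = record { isTotalOrder = isTotalOrder }

  open NonStrictToStrict _≡_ _≤_ public using (_<_)
  open Max totalOrder public using (_⊔_)
  open Min totalOrder public using (_⊓_)

  _-_ _÷_ : Carrier → Carrier → Carrier
  x - y = x + - y
  x ÷ y = x * y ⁻¹

  ∣_∣ : Carrier → Carrier
  ∣ x ∣ = x ⊔ - x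

  fromℕ : ℕ → Carrier
  fromℕ zero    = 0#
  fromℕ (suc n) = 1# + fromℕ n

  -- ∑[ n ] f = f 0 + … + f (n - 1)
  ∑[_] : ℕ → (ℕ → Carrier) → Carrier
  ∑[ zero  ] f = 0#
  ∑[ suc n ] f = ∑[ n ] f + f n

module Analysis (R : RealField) where
  open RealField R renaming (Carrier to ℝ)

  record IsNorm (ν : ℝ → ℝ) : Set where
    field
      nonNegative : ∀ x → 0# ≤ ν x
      definite    : ∀ x → ν x ≡ 0# → x ≡ 0#
      homogeneous : ∀ a x → ν (a * x) ≡ ∣ a ∣ * ν x
      triangle    : ∀ x y → ν (x + y) ≤ ν x + ν y

  IsMinimizer : {A : Set} → (A → Set) → (A → ℝ) → A → Set
  IsMinimizer P f a = P a × (∀ b → P b → f a ≤ f b)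

  IsMinimum : {A : Set} → (A → Set) → (A → ℝ) → ℝ → Set
  IsMinimum P f v = ∃ λ a → IsMinimizer P f a × f a ≡ v

  InSeed : ℝ → Set
  InSeed r = - 1# < r × r < 1#

  -- RiemannSum f δ a b s: s is the Riemann sum of f for a tagged partition
  -- of [a, b] of mesh at most δ.  The tags are taken in (-1, 1), the only
  -- place where a function of the random seed is meaningful.
  data RiemannSum (f : ℝ → ℝ) (δ : ℝ) : ℝ → ℝ → ℝ → Set where
    empty : ∀ {a} → RiemannSum f δ a a 0#
    cell  : ∀ {a m b s} (τ : ℝ) → a ≤ τ → τ ≤ m → InSeed τ → m - a ≤ δ →
            RiemannSum f δ m b s → RiemannSum f δ a b ((m - a) * f τ + s)

  -- e = 𝔼[f(r)] for r uniform on (-1, 1), that is, f is Riemann integrable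
  -- and e = ½ ∫₋₁¹ f.
  IsExpectation : (ℝ → ℝ) → ℝ → Set
  IsExpectation f e =
    ∀ ε → 0# < ε → ∃ λ δ → 0# < δ ×
    (∀ s → RiemannSum f δ (- 1#) 1# s → ∣ (1# + 1#) ⁻¹ * s - e ∣ ≤ ε)

-- The constants G and B bound the subgradients and the values of all cost
-- functions.
record Problem (R : RealField) : Set where
  open RealField R renaming (Carrier to ℝ)
  open Analysis R
  field
    xL xH  : ℝ
    0≤xL   : 0# ≤ xL
    xL≤xH  : xL ≤ xH
    ∥_∥    : ℝ → ℝ
    isNorm : IsNorm ∥_∥
    G B    : ℝ

module SOCO {R : RealField} (𝒫 : Problem R) where
  open RealField R renaming (Carrier to ℝ)
  open Analysis R
  open Problem 𝒫

  F : ℝ → Set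
  F x = xL ≤ x × x ≤ xH

  -- Only the restriction to F of a cost function matters.
  Cost : Set
  Cost = ℝ → ℝ

  IsSubgradient : Cost → ℝ → ℝ → Set
  IsSubgradient c x g = ∀ y → F y → c x + g * (y - x) ≤ c y

  record IsAdmissible (c : Cost) : Set where
    field
      nonNegative : ∀ x → F x → 0# ≤ c x
      bounded     : ∀ x → F x → c x ≤ B
      convex      : ∀ x y λ′ → F x → F y → 0# ≤ λ′ → λ′ ≤ 1# →
                    c (λ′ * x + (1# - λ′) * y) ≤ λ′ * c x + (1# - λ′) * c y
      -- At an endpoint of F the set of all subgradients is never bounded, so
      -- one asks for a bounded subgradient at each point.
      subgradient : ∀ x → F x → ∃ λ g → ∣ g ∣ ≤ G × IsSubgradient c x g

  -- Sequences are indexed from 0: the mathematical cᵗ is c (t - 1).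
  AdmissibleSequence : (ℕ → Cost) → Set
  AdmissibleSequence c = ∀ t → IsAdmissible (c t)

  -- Given the random seed, drawn uniformly from (-1, 1), and the cost
  -- functions seen so far, the most recent one first, choose an action.
  Algorithm : Set
  Algorithm = ℝ → List Cost → ℝ

  -- The actions xⁱ, xⁱ⁺¹, xⁱ⁺², … with the convention xⁱ = 0; for s > i, the
  -- action xˢ is chosen knowing c¹, …, cˢ⁻¹.
  actions : Algorithm → (ℕ → Cost) → (i : ℕ) → ℝ → ℕ → ℝ
  actions A c i r zero    = 0#
  actions A c i r (suc t) = A r (applyDownFrom c (i ℕ.+ t))

  -- ∑_{t=1}^T cᵗ(xᵗ) + α ∥xᵗ - xᵗ⁻¹∥
  totalCost : ℝ → (ℕ → Cost) → ℕ → (ℕ → ℝ) → ℝ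
  totalCost α c T x = ∑[ T ] λ t → c t (x (suc t)) + α * ∥ x (suc t) - x t ∥

  -- Cᵢ^α(A) = v, on the first T functions of the sequence c
  IsExpectedCost : (i : ℕ) (α : ℝ) → Algorithm → (ℕ → Cost) → ℕ → ℝ → Set
  IsExpectedCost i α A c T =
    IsExpectation (λ r → totalCost α c T (actions A c i r))

  IsOPT-s : (ℕ → Cost) → ℕ → ℝ → Set
  IsOPT-s c T = IsMinimum F (λ x → ∑[ T ] λ t → c t x)

  -- Terms x t with t > T are unconstrained and do not enter the cost.
  IsTrajectory : ℕ → (ℕ → ℝ) → Set
  IsTrajectory T x = x 0 ≡ 0# × (∀ t → t ℕ.< T → F (x (suc t)))

  IsOPT-d : ℝ → (ℕ → Cost) → ℕ → ℝ → Set
  IsOPT-d α c T = IsMinimum (IsTrajectory T) (totalCost α c T)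

  -- R′₀(A) ≤ ρ(T)
  RegretAtMost : Algorithm → (ℕ → ℝ) → Set
  RegretAtMost A ρ =
    ∀ c → AdmissibleSequence c → ∀ T opt → IsOPT-s c T opt →
    ∃ λ v → IsExpectedCost 0 1# A c T v × v - opt ≤ ρ T

  -- CR₁^α(A) ≤ ρ; the O(1) term κ depends on neither c nor T.
  CompetitiveRatioAtMost : (α : ℝ) → Algorithm → ℝ → Set
  CompetitiveRatioAtMost α A ρ =
    ∃ λ κ → ∀ c → AdmissibleSequence c → ∀ T opt → IsOPT-d α c T opt →
    ∃ λ v → IsExpectedCost 1 1# A c T v × v ≤ ρ * opt + κ

  -- IsWorkFunction N (cᵗ ∷ … ∷ c¹ ∷ []) w: on F, w is the work function wᵗ.
  data IsWorkFunction (N : ℝ → ℝ) : List Cost → (ℝ → ℝ) → Set where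
    initial : ∀ {w} → (∀ x → F x → w x ≡ N x) → IsWorkFunction N [] w
    step    : ∀ {c h w w′} → IsWorkFunction N h w →
              (∀ x → F x → IsMinimum F (λ y → w y + c y + N (x - y)) (w′ x)) →
              IsWorkFunction N (c ∷ h) w′

  -- Ties between minimizers may be broken arbitrarily.
  IsRBG : (ℝ → ℝ) → Algorithm → Set
  IsRBG N A =
    ∀ r → InSeed r → ∀ h w → IsWorkFunction N h w →
    IsMinimizer F (λ x → w x + r * N x) (A r h)

module Submission where

-- Write n for N 1, so that N x = n x on F, and m t r for the minimum of
-- wᵗ(x) + r N(x) over F, attained at the action Xₜ(r).  As |r| < 1, the minimum
-- defining wᵗ⁺¹ at Xₜ₊₁(r) is attained without moving, whence
--   cᵗ⁺¹(Xₜ₊₁(r)) ≤ m (t + 1) r - m t r.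
-- The sum over t telescopes, and since 𝔼[r] = 0 the expected service cost is at
-- most wᵀ(v), for every v in F.  For the movement, m t is concave in r with
-- slope n Xₜ(r), a decreasing function, and by convexity Xₜ₊₁(r) lies on the
-- same side of Xₜ(r) as the minimizer of cᵗ⁺¹.  So D = m (t + 1) - m t first
-- falls and then rises, at speed n |Xₜ₊₁ - Xₜ|; as D ≥ 0, the expected movement
-- is at most ½ (D(1) + D(-1)), which again telescopes to wᵀ(v).  Thus RBG pays
-- at most wᵀ(v) for service and wᵀ(v) / θ for movement, up to a constant.
--
-- The total cost has bounded variation in r, hence is Riemann integrable.  The
-- estimates above are carried out on averages over the midpoints of uniform
-- subdivisions of [-1, 1], with an error that vanishes with the mesh.

open import Defs
open import Algebra.Bundles using (CommutativeRing)
import Algebra.Construct.NaturalChoice.Max as Max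
import Algebra.Construct.NaturalChoice.MaxOp as MaxOp
import Algebra.Construct.NaturalChoice.Min as Min
import Algebra.Construct.NaturalChoice.MinOp as MinOp
import Algebra.Properties.Ring as RingProperties
import Algebra.Properties.Semiring.Mult.TCOptimised as Mult
import Algebra.Solver.Ring as RingSolver
open import Algebra.Solver.Ring.AlmostCommutativeRing
  using (AlmostCommutativeRing; fromCommutativeRing; _-Raw-AlmostCommutative⟶_)
open import Axiom.ExcludedMiddle using (ExcludedMiddle)
open import Data.Empty using (⊥; ⊥-elim)
import Data.Integer.Base as ℤ
import Data.Integer.Properties as ℤ
open import Data.List.Base using (applyDownFrom)
import Data.Maybe.Base as Maybe
open import Data.Nat.Base as ℕ using (ℕ; zero; suc)
import Data.Nat.Properties as ℕ
open import Data.Product.Base using (∃; _×_; _,_; proj₁; proj₂)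
import Data.Sign.Base as Sign
open import Data.Sum.Base using (_⊎_; inj₁; inj₂)
open import Level using (0ℓ)
open import Relation.Binary.PropositionalEquality
  using (_≡_; refl; sym; trans; cong; cong₂; subst; subst₂; module ≡-Reasoning)
open import Relation.Binary.Structures using (IsTotalOrder)
open import Relation.Nullary using (¬_; yes; no)
open import Relation.Nullary.Decidable.Core using (dec⇒maybe)

-- Ties between minimizers are broken arbitrarily, so an action is only known to be monotone in the
-- seed and may jump; at a single seed, ties can even let it move away from the minimizer of the
-- cost. Comparisons therefore pair the new action at one grid seed with the old action at a
-- neighbouring one. For fixed `T` this shift costs a multiple of the mesh, because the increments
-- of monotone functions telescope.
--
-- Both guarantees come from one inequality for the expected cost `e`:
-- `n * e ≤ (n + β) * w T v + n * κ`. With lookahead 1, `β` is `∥ 1# ∥` and (n + β) / n = (1 + θ) /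
-- θ; the offline optimum weights moves by α where the work function weights them by θ, which costs
-- a further factor θ / min{θ, α}. Without lookahead each cost is paid one action too early, which
-- raises `β` by `G`; with `v` the static optimum, wᵀ(v) ≤ OPT_s + n v, so the regret is of order
-- OPT_s / θ + θ, and OPT_s ≤ T B.

-- Polynomial identities with integer coefficients.

module FieldSolver (R : RealField) where
  open RealField R

  commutativeRing : CommutativeRing 0ℓ 0ℓ
  commutativeRing = record { isCommutativeRing = isCommutativeRing }

  open CommutativeRing commutativeRing
    using (ring; semiring; +-identityˡ; +-identityʳ; -‿inverseʳ; +-assoc; +-comm)
  open RingProperties ring using (-0#≈0#; -‿involutive; -‿+-comm; -‿distribˡ-*; -‿distribʳ-*)
  open Mult semiring using (1+×; ×-homo-+; ×1-homo-*) renaming (_×_ to _·_)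
  open ≡-Reasoning

  -- With this version of the integer multiple, 0 and 1 are sent to `0#` and `1#` definitionally, so
  -- `:0` and `:1` denote the constants of the field itself.
  fromℤ : ℤ.ℤ → Carrier
  fromℤ (ℤ.+ n)    = n · 1#
  fromℤ ℤ.-[1+ n ] = - (suc n · 1#)

  private
    cancel-1 : ∀ x y → x - y ≡ (1# + x) - (1# + y)
    cancel-1 x y = sym (begin
      (1# + x) + - (1# + y)     ≡⟨ cong ((1# + x) +_) (-‿+-comm 1# y) ⟨
      (1# + x) + (- 1# + - y)   ≡⟨ cong (_+ (- 1# + - y)) (+-comm 1# x) ⟩
      (x + 1#) + (- 1# + - y)   ≡⟨ +-assoc x 1# _ ⟩
      x + (1# + (- 1# + - y))   ≡⟨ cong (x +_) (+-assoc 1# (- 1#) (- y)) ⟨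
      x + ((1# + - 1#) + - y)   ≡⟨ cong (λ z → x + (z + - y)) (-‿inverseʳ 1#) ⟩
      x + (0# + - y)            ≡⟨ cong (x +_) (+-identityˡ _) ⟩
      x - y                     ∎)

    fromℤ-⊖ : ∀ m n → fromℤ (m ℤ.⊖ n) ≡ m · 1# - n · 1#
    fromℤ-⊖ zero    zero    = sym (-‿inverseʳ 0#)
    fromℤ-⊖ zero    (suc n) = sym (+-identityˡ _)
    fromℤ-⊖ (suc m) zero    = sym (trans (cong (suc m · 1# +_) -0#≈0#) (+-identityʳ _))
    fromℤ-⊖ (suc m) (suc n) = begin
      fromℤ (suc m ℤ.⊖ suc n)               ≡⟨ cong fromℤ (ℤ.[1+m]⊖[1+n]≡m⊖n m n) ⟩
      fromℤ (m ℤ.⊖ n)                       ≡⟨ fromℤ-⊖ m n ⟩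
      m · 1# - n · 1#                       ≡⟨ cancel-1 _ _ ⟩
      (1# + m · 1#) - (1# + n · 1#)         ≡⟨ cong₂ _-_ (1+× m 1#) (1+× n 1#) ⟨
      suc m · 1# - suc n · 1#               ∎

    fromℤ-+ : ∀ i j → fromℤ (i ℤ.+ j) ≡ fromℤ i + fromℤ j
    fromℤ-+ (ℤ.+ m)    (ℤ.+ n)    = ×-homo-+ 1# m n
    fromℤ-+ (ℤ.+ m)    ℤ.-[1+ n ] = fromℤ-⊖ m (suc n)
    fromℤ-+ ℤ.-[1+ m ] (ℤ.+ n)    = trans (fromℤ-⊖ n (suc m)) (+-comm _ _)
    fromℤ-+ ℤ.-[1+ m ] ℤ.-[1+ n ] = begin
      - (suc (suc (m ℕ.+ n)) · 1#)          ≡⟨ cong (λ k → - (suc k · 1#)) (ℕ.+-suc m n) ⟨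
      - ((suc m ℕ.+ suc n) · 1#)            ≡⟨ cong -_ (×-homo-+ 1# (suc m) (suc n)) ⟩
      - (suc m · 1# + suc n · 1#)           ≡⟨ -‿+-comm _ _ ⟨
      - (suc m · 1#) + - (suc n · 1#)       ∎

    fromℤ-neg : ∀ i → fromℤ (ℤ.- i) ≡ - fromℤ i
    fromℤ-neg (ℤ.+ zero)  = sym -0#≈0#
    fromℤ-neg ℤ.+[1+ n ]  = refl
    fromℤ-neg ℤ.-[1+ n ]  = sym (-‿involutive _)

    fromℤ-◃ : ∀ n → fromℤ (Sign.- ℤ.◃ n) ≡ - (n · 1#)
    fromℤ-◃ zero    = sym -0#≈0#
    fromℤ-◃ (suc n) = refl

    fromℤ-* : ∀ i j → fromℤ (i ℤ.* j) ≡ fromℤ i * fromℤ j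
    fromℤ-* (ℤ.+ m) (ℤ.+ n) = begin
      fromℤ (Sign.+ ℤ.◃ m ℕ.* n)     ≡⟨ cong fromℤ (ℤ.+◃n≡+n (m ℕ.* n)) ⟩
      (m ℕ.* n) · 1#                 ≡⟨ ×1-homo-* m n ⟩
      (m · 1#) * (n · 1#)            ∎
    fromℤ-* (ℤ.+ m) ℤ.-[1+ n ] = begin
      fromℤ (Sign.- ℤ.◃ m ℕ.* suc n) ≡⟨ fromℤ-◃ (m ℕ.* suc n) ⟩
      - ((m ℕ.* suc n) · 1#)         ≡⟨ cong -_ (×1-homo-* m (suc n)) ⟩
      - ((m · 1#) * (suc n · 1#))    ≡⟨ -‿distribʳ-* _ _ ⟩
      (m · 1#) * - (suc n · 1#)      ∎
    fromℤ-* ℤ.-[1+ m ] (ℤ.+ n) = begin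
      fromℤ (Sign.- ℤ.◃ suc m ℕ.* n) ≡⟨ fromℤ-◃ (suc m ℕ.* n) ⟩
      - ((suc m ℕ.* n) · 1#)         ≡⟨ cong -_ (×1-homo-* (suc m) n) ⟩
      - ((suc m · 1#) * (n · 1#))    ≡⟨ -‿distribˡ-* _ _ ⟩
      - (suc m · 1#) * (n · 1#)      ∎
    fromℤ-* ℤ.-[1+ m ] ℤ.-[1+ n ] = begin
      (suc m ℕ.* suc n) · 1#         ≡⟨ ×1-homo-* (suc m) (suc n) ⟩
      (suc m · 1#) * (suc n · 1#)    ≡⟨ -‿involutive _ ⟨
      - - ((suc m · 1#) * (suc n · 1#)) ≡⟨ cong -_ (-‿distribˡ-* _ _) ⟩
      - (- (suc m · 1#) * (suc n · 1#)) ≡⟨ -‿distribʳ-* _ _ ⟩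
      - (suc m · 1#) * - (suc n · 1#) ∎

  almostCommutativeRing : AlmostCommutativeRing 0ℓ 0ℓ
  almostCommutativeRing = fromCommutativeRing commutativeRing

  fromℤ-morphism : ℤ.+-*-rawRing -Raw-AlmostCommutative⟶ almostCommutativeRing
  fromℤ-morphism = record
    { ⟦_⟧    = fromℤ
    ; +-homo = fromℤ-+
    ; *-homo = fromℤ-*
    ; -‿homo = fromℤ-neg
    ; 0-homo = refl
    ; 1-homo = refl
    }

  open RingSolver ℤ.+-*-rawRing almostCommutativeRing fromℤ-morphism
    (λ i j → Maybe.map (cong fromℤ) (dec⇒maybe (i ℤ.≟ j))) public
    using (solve; _:=_; _:+_; _:-_; _:*_; :-_; con; Polynomial)

  :0 :1 : ∀ {n} → Polynomial n
  :0 = con (ℤ.+ 0)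
  :1 = con (ℤ.+ 1)

-- Order, completeness, and the existence of minimizers.

module OrderedField (em : ExcludedMiddle 0ℓ) (R : RealField) where
  open RealField R
  open FieldSolver R

  open IsTotalOrder isTotalOrder public
    using ()
    renaming (refl to ≤-refl; reflexive to ≤-reflexive; trans to ≤-trans; antisym to ≤-antisym;
              total to ≤-total)

  open MaxOp (Max.maxOperator totalOrder) public
    using (⊔-lub; x≤x⊔y; x≤y⊔x)
  open MinOp (Min.minOperator totalOrder) public
    using (⊓-glb; x⊓y≤x; x⊓y≤y)

  infixr 5 _⊕_

  ≤-via : ∀ {x y} → 0# ≤ y - x → x ≤ y
  ≤-via {x} {y} p = subst₂ _≤_ (solve 1 (λ x → x :+ :0 := x) refl x)
    (solve 2 (λ x y → x :+ (y :- x) := y) refl x y) (+-monoʳ-≤ x p)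

  0≤y-x : ∀ {x y} → x ≤ y → 0# ≤ y - x
  0≤y-x {x} {y} p = subst₂ _≤_ (solve 1 (λ x → :- x :+ x := :0) refl x)
    (solve 2 (λ x y → :- x :+ y := y :- x) refl x y) (+-monoʳ-≤ (- x) p)

  _⊕_ : ∀ {x y x′ y′} → x ≤ y → x′ ≤ y′ → x + x′ ≤ y + y′
  _⊕_ {x} {y} {x′} {y′} p q = ≤-trans (+-monoʳ-≤ x q)
    (subst₂ _≤_ (solve 2 (λ x y → y :+ x := x :+ y) refl x y′)
                (solve 2 (λ x y → y :+ x := x :+ y) refl y y′) (+-monoʳ-≤ y′ p))

  -- Reduces an inequality that follows linearly from known ones to an identity
  -- for the ring solver.
  linear : ∀ {x y a b} → x ≤ y → b - a ≡ y - x → a ≤ b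
  linear p eq = ≤-via (subst (0# ≤_) (sym eq) (0≤y-x p))

  *-monoʳ-≤ : ∀ {a x y} → 0# ≤ a → x ≤ y → a * x ≤ a * y
  *-monoʳ-≤ 0≤a x≤y = linear (*-nonNegative 0≤a (0≤y-x x≤y))
    (solve 3 (λ a x y → a :* y :- a :* x := a :* (y :- x) :- :0) refl _ _ _)

  *-monoˡ-≤ : ∀ {a x y} → 0# ≤ a → x ≤ y → x * a ≤ y * a
  *-monoˡ-≤ 0≤a x≤y = linear (*-nonNegative 0≤a (0≤y-x x≤y))
    (solve 3 (λ a x y → y :* a :- x :* a := a :* (y :- x) :- :0) refl _ _ _)

  <⇒≤ : ∀ {x y} → x < y → x ≤ y
  <⇒≤ = proj₁

  <⇒≱ : ∀ {x y} → x < y → ¬ y ≤ x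
  <⇒≱ (x≤y , x≢y) y≤x = x≢y (≤-antisym x≤y y≤x)

  ≰⇒> : ∀ {x y} → ¬ y ≤ x → x < y
  ≰⇒> {x} {y} y≰x with ≤-total x y
  ... | inj₁ x≤y = x≤y , λ { refl → y≰x ≤-refl }
  ... | inj₂ y≤x = ⊥-elim (y≰x y≤x)

  ≮⇒≥ : ∀ {x y} → ¬ x < y → y ≤ x
  ≮⇒≥ {x} {y} x≮y with em {y ≤ x}
  ... | yes y≤x = y≤x
  ... | no  y≰x = ⊥-elim (x≮y (≰⇒> y≰x))

  ≤⊎> : ∀ x y → x ≤ y ⊎ y < x
  ≤⊎> x y with em {x ≤ y}
  ... | yes x≤y = inj₁ x≤y
  ... | no  x≰y = inj₂ (≰⇒> x≰y)

  <-≤-trans : ∀ {x y z} → x < y → y ≤ z → x < z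
  <-≤-trans x<y y≤z = ≰⇒> λ z≤x → <⇒≱ x<y (≤-trans y≤z z≤x)

  ≤-<-trans : ∀ {x y z} → x ≤ y → y < z → x < z
  ≤-<-trans x≤y y<z = ≰⇒> λ z≤x → <⇒≱ y<z (≤-trans z≤x x≤y)

  0≤1 : 0# ≤ 1#
  0≤1 with ≤-total 0# 1#
  ... | inj₁ p = p
  ... | inj₂ p = linear (*-nonNegative q q)
        (solve 0 (:1 :- :0 := (:0 :- :1) :* (:0 :- :1) :- :0) refl)
    where q = 0≤y-x p

  0<1 : 0# < 1#
  0<1 = 0≤1 , 0≢1

  0<y-x : ∀ {x y} → x < y → 0# < y - x
  0<y-x x<y = ≰⇒> λ p → <⇒≱ x<y (linear p (solve 2 (λ x y → x :- y := :0 :- (y :- x)) refl _ _))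

  *-inverse : ∀ {x} → 0# < x → x * x ⁻¹ ≡ 1#
  *-inverse (_ , 0≢x) = *-inverseʳ _ λ x≡0 → 0≢x (sym x≡0)

  *-zeroʳ : ∀ {x} → x * 0# ≡ 0#
  *-zeroʳ = solve 1 (λ x → x :* :0 := :0) refl _

  ⁻¹-nonNegative : ∀ {x} → 0# < x → 0# ≤ x ⁻¹
  ⁻¹-nonNegative {x} 0<x with ≤-total 0# (x ⁻¹)
  ... | inj₁ p = p
  ... | inj₂ p = ⊥-elim (<⇒≱ 0<1
    (subst₂ _≤_ (*-inverse 0<x) *-zeroʳ (*-monoʳ-≤ (<⇒≤ 0<x) p)))

  *-inverse-cancel : ∀ {a x} → 0# < a → a * (a ⁻¹ * x) ≡ x
  *-inverse-cancel {a} {x} 0<a = begin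
    a * (a ⁻¹ * x)   ≡⟨ solve 3 (λ a b x → a :* (b :* x) := (a :* b) :* x) refl _ _ _ ⟩
    (a * a ⁻¹) * x   ≡⟨ cong (_* x) (*-inverse 0<a) ⟩
    1# * x           ≡⟨ solve 1 (λ x → :1 :* x := x) refl x ⟩
    x                ∎
    where open ≡-Reasoning

  *-cancelˡ-≤ : ∀ {a x y} → 0# < a → a * x ≤ a * y → x ≤ y
  *-cancelˡ-≤ {a} {x} {y} 0<a p = subst₂ _≤_ (lemma x) (lemma y) (*-monoʳ-≤ (⁻¹-nonNegative 0<a) p)
    where
    lemma : ∀ z → a ⁻¹ * (a * z) ≡ z
    lemma z = trans
          (solve 3 (λ a b z → b :* (a :* z) := a :* (b :* z)) refl _ _ _) (*-inverse-cancel 0<a)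

  *-positive : ∀ {x y} → 0# < x → 0# < y → 0# < x * y
  *-positive 0<x 0<y = ≰⇒> λ p → <⇒≱ 0<y (*-cancelˡ-≤ 0<x (≤-trans p (≤-reflexive (sym *-zeroʳ))))

  ⁻¹-positive : ∀ {x} → 0# < x → 0# < x ⁻¹
  ⁻¹-positive {x} 0<x = ⁻¹-nonNegative 0<x , λ 0≡x⁻¹ →
    0≢1 (trans (sym *-zeroʳ) (trans (cong (x *_) 0≡x⁻¹) (*-inverse 0<x)))

  +-positive : ∀ {x y} → 0# ≤ x → 0# < y → 0# < x + y
  +-positive 0≤x 0<y = <-≤-trans 0<y (linear 0≤x
        (solve 2 (λ x y → (x :+ y) :- y := x :- :0) refl _ _))

  2# : Carrier
  2# = 1# + 1#

  0<2 : 0# < 2#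
  0<2 = +-positive 0≤1 0<1

  0≤2 : 0# ≤ 2#
  0≤2 = <⇒≤ 0<2

  half : ∀ x → 2# ⁻¹ * x + 2# ⁻¹ * x ≡ x
  half x = trans
        (solve 2 (λ h x → h :* x :+ h :* x := (:1 :+ :1) :* (h :* x)) refl _ _)
        (*-inverse-cancel 0<2)

  ∣∣-lub : ∀ {x y} → x ≤ y → - x ≤ y → ∣ x ∣ ≤ y
  ∣∣-lub = ⊔-lub

  x≤∣x∣ : ∀ {x} → x ≤ ∣ x ∣
  x≤∣x∣ = x≤x⊔y _ _

  -x≤∣x∣ : ∀ {x} → - x ≤ ∣ x ∣
  -x≤∣x∣ = x≤y⊔x _ _

  ∣x-y∣≥y-x : ∀ {x y} → y - x ≤ ∣ x - y ∣
  ∣x-y∣≥y-x = linear -x≤∣x∣ (solve 3 (λ a x y → a :- (y :- x) := a :- :- (x :- y)) refl _ _ _)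

  ∣x-y∣-lub : ∀ {x y z} → x - y ≤ z → y - x ≤ z → ∣ x - y ∣ ≤ z
  ∣x-y∣-lub p q = ∣∣-lub p (linear q
        (solve 3 (λ z x y → z :- :- (x :- y) := z :- (y :- x)) refl _ _ _))

  ∣x-y∣-swap : ∀ {x y} → ∣ x - y ∣ ≤ ∣ y - x ∣
  ∣x-y∣-swap = ∣x-y∣-lub ∣x-y∣≥y-x x≤∣x∣

  0≤∣x∣ : ∀ {x} → 0# ≤ ∣ x ∣
  0≤∣x∣ {x} with ≤-total 0# x
  ... | inj₁ p = ≤-trans p x≤∣x∣
  ... | inj₂ p = ≤-trans (linear p (solve 1 (λ x → :- x :- :0 := :0 :- x) refl _)) -x≤∣x∣

  0≤x⇒∣x∣≡x : ∀ {x} → 0# ≤ x → ∣ x ∣ ≡ x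
  0≤x⇒∣x∣≡x p = ≤-antisym
    (∣∣-lub ≤-refl (linear (p ⊕ p)
          (solve 1 (λ x → x :- :- x := x :+ x :- (:0 :+ :0)) refl _))) x≤∣x∣

  ∣∣-triangle : ∀ {x y} z → ∣ x - y ∣ ≤ ∣ x - z ∣ + ∣ z - y ∣
  ∣∣-triangle {x} {y} z = ∣x-y∣-lub
    (linear (x≤∣x∣ {x - z} ⊕ x≤∣x∣ {z - y})
      (solve 5 (λ x y z a b → (a :+ b) :- (x :- y) := (a :+ b) :- ((x :- z) :+ (z :- y)))
            refl _ _ _ _ _))
    (linear (∣x-y∣≥y-x {x} {z} ⊕ ∣x-y∣≥y-x {z} {y})
      (solve 5 (λ x y z a b → (a :+ b) :- (y :- x) := (a :+ b) :- ((z :- x) :+ (y :- z)))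
            refl _ _ _ _ _))

  ∣x-x∣≤0 : ∀ {x} → ∣ x - x ∣ ≤ 0#
  ∣x-x∣≤0 = ∣x-y∣-lub p p
    where p = ≤-reflexive (solve 1 (λ x → x :- x := :0) refl _)

  -- A violation is refuted at ε = (x - y) / (b + 1), where `y + b * ε` equals `x - ε`. The `1#`
  -- keeps the divisor positive when `b` is zero.
  ≤-limit : ∀ {x y b} → 0# ≤ b → (∀ ε → 0# < ε → x ≤ y + b * ε) → x ≤ y
  ≤-limit {x} {y} {b} 0≤b h with ≤⊎> x y
  ... | inj₁ x≤y = x≤y
  ... | inj₂ y<x = ⊥-elim (<⇒≱ 0<ε
      (linear (h ε 0<ε) (trans
        (solve 3 (λ b y ε → :0 :- ε := y :+ b :* ε :- (y :+ (b :+ :1) :* ε)) refl _ _ _)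
        (cong (λ z → y + b * ε - z) (trans (cong (y +_) scale)
          (solve 2 (λ x y → y :+ (x :- y) := x) refl _ _))))))
    where
    0<b+1 : 0# < b + 1#
    0<b+1 = +-positive 0≤b 0<1
    ε : Carrier
    ε = (b + 1#) ⁻¹ * (x - y)
    0<ε : 0# < ε
    0<ε = *-positive (⁻¹-positive 0<b+1) (0<y-x y<x)
    scale : (b + 1#) * ε ≡ x - y
    scale = *-inverse-cancel 0<b+1

  archimedean : ∀ x → ∃ λ k → x ≤ fromℕ k
  archimedean x with em {∃ λ k → x ≤ fromℕ k}
  ... | yes p = p
  ... | no ¬p with supremum (λ y → ∃ λ k → y ≡ fromℕ k) (0# , 0 , refl) (x , bound)
    where
    bound : ∀ y → (∃ λ k → y ≡ fromℕ k) → y ≤ x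
    bound _ (k , refl) = <⇒≤ (≰⇒> λ p → ¬p (k , p))
  ... | s , upper , least = ⊥-elim (<⇒≱ 0<1 (linear (least (s - 1#) below)
      (solve 1 (λ s → :0 :- :1 := s :- :1 :- s) refl s)))
    where
    below : ∀ y → (∃ λ k → y ≡ fromℕ k) → y ≤ s - 1#
    below _ (k , refl) = linear (upper _ (suc k , refl))
      (solve 2 (λ s k → s :- :1 :- k := s :- (:1 :+ k)) refl s (fromℕ k))

  fromℕ-positive : ∀ k → 0# < fromℕ (suc k)
  fromℕ-positive zero    = <-≤-trans 0<1 (≤-reflexive (solve 0 (:1 := :1 :+ :0) refl))
  fromℕ-positive (suc k) = +-positive 0≤1 (fromℕ-positive k)

  fromℕ-nonNegative : ∀ k → 0# ≤ fromℕ k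
  fromℕ-nonNegative zero    = ≤-refl
  fromℕ-nonNegative (suc k) = <⇒≤ (fromℕ-positive k)

  small-reciprocal : ∀ {ε} → 0# < ε → ∃ λ k → fromℕ (suc k) ⁻¹ ≤ ε
  small-reciprocal {ε} 0<ε with archimedean (ε ⁻¹)
  ... | k , p = k , *-cancelˡ-≤ (fromℕ-positive k)
        (≤-trans (≤-reflexive (*-inverse (fromℕ-positive k)))
      (≤-trans (≤-reflexive (sym (*-inverse 0<ε)))
      (≤-trans (*-monoʳ-≤ (<⇒≤ 0<ε)
            (≤-trans p (linear 0≤1 (solve 1 (λ k → :1 :+ k :- k := :1 :- :0) refl _))))
        (≤-reflexive (solve 2 (λ a b → a :* b := b :* a) refl _ _)))))

  -- The minimizer is the supremum of the points x to the right of which f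
  -- undercuts each of its values.
  lipschitz-minimizer : ∀ {a b L} (f : Carrier → Carrier) → a ≤ b → 0# ≤ L →
    (∀ x y → a ≤ x × x ≤ b → a ≤ y × y ≤ b → f x - f y ≤ L * ∣ x - y ∣) →
    ∃ λ s → (a ≤ s × s ≤ b) × (∀ y → a ≤ y × y ≤ b → f s ≤ f y)
  lipschitz-minimizer {a} {b} {L} f a≤b 0≤L lip = s , s∈ , minimal
    where
    In Q : Carrier → Set
    In x = a ≤ x × x ≤ b
    Q x = In x × (∀ y → In y → ∃ λ z → In z × x ≤ z × f z ≤ f y)
    Qa : Q a
    Qa = (≤-refl , a≤b) , λ y y∈ → y , y∈ , proj₁ y∈ , ≤-refl
    sup = supremum Q (a , Qa) (b , λ x Qx → proj₂ (proj₁ Qx))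
    s = proj₁ sup
    upper = proj₁ (proj₂ sup)
    least = proj₂ (proj₂ sup)
    s∈ : In s
    s∈ = upper a Qa , least b (λ x Qx → proj₂ (proj₁ Qx))
    minimal : ∀ y → In y → f s ≤ f y
    minimal y y∈ = ≮⇒≥ λ fy<fs → contra fy<fs
      where
      contra : f y < f s → ⊥
      contra fy<fs = none (λ x Qx → ≮⇒≥ (near x Qx))
        where
        0<L+1 : 0# < L + 1#
        0<L+1 = +-positive 0≤L 0<1
        -- Within distance `δ` of `s` the function drops by at most `L * δ`, which is less than
        -- `f s - f y`. So a point that is at least `s - δ` and has a value at most `f y` lies
        -- beyond `s + δ`. Any member of `Q` above `s - δ` would thus put `s + δ` into `Q`, and if
        -- there is none, `s - δ` is a smaller upper bound.
        δ = (L + 1#) ⁻¹ * (f s - f y)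
        0<δ : 0# < δ
        0<δ = *-positive (⁻¹-positive 0<L+1) (0<y-x fy<fs)
        gap : (L + 1#) * δ ≡ f s - f y
        gap = *-inverse-cancel 0<L+1
        far : ∀ z → In z → s - δ ≤ z → f z ≤ f y → s + δ ≤ z
        far z z∈ s-δ≤z fz≤fy with ≤⊎> (s + δ) z
        ... | inj₁ s+δ≤z = s+δ≤z
        ... | inj₂ z<s+δ = ⊥-elim (<⇒≱ 0<δ
          (linear (lip s z s∈ z∈ ⊕ *-monoʳ-≤ 0≤L close ⊕ fz≤fy ⊕ ≤-reflexive gap)
            (solve 6 (λ L δ d fs fy fz → :0 :- δ :=
              (L :* d :+ (L :* δ :+ (fy :+ (fs :- fy))))
                    :- ((fs :- fz) :+ (L :* d :+ (fz :+ (L :+ :1) :* δ))))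
              refl _ _ _ _ _ _)))
          where
          close : ∣ s - z ∣ ≤ δ
          close = ∣x-y∣-lub
            (linear s-δ≤z (solve 3 (λ s z δ → δ :- (s :- z) := z :- (s :- δ)) refl _ _ _))
            (linear (<⇒≤ z<s+δ) (solve 3 (λ s z δ → δ :- (z :- s) := (s :+ δ) :- z) refl _ _ _))
        near : ∀ x → Q x → ¬ (s - δ < x)
        near x (x∈ , Qx) s-δ<x = <⇒≱ 0<δ (linear (upper (s + δ) (s+δ∈ , Qs+δ))
          (solve 2 (λ s δ → :0 :- δ := s :- (s :+ δ)) refl _ _))
          where
          z  = proj₁ (Qx y y∈)
          z∈ = proj₁ (proj₂ (Qx y y∈))
          fz≤fy = proj₂ (proj₂ (proj₂ (Qx y y∈)))
          s+δ≤z : s + δ ≤ z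
          s+δ≤z = far z z∈ (≤-trans (<⇒≤ s-δ<x) (proj₁ (proj₂ (proj₂ (Qx y y∈))))) fz≤fy
          s+δ∈ : In (s + δ)
          s+δ∈ = linear (proj₁ s∈ ⊕ <⇒≤ 0<δ)
                   (solve 3 (λ a s δ → s :+ δ :- a := (s :+ δ) :- (a :+ :0)) refl _ _ _)
               , ≤-trans s+δ≤z (proj₂ z∈)
          Qs+δ : ∀ y′ → In y′ → ∃ λ z → In z × s + δ ≤ z × f z ≤ f y′
          Qs+δ y′ y′∈ with ≤-total (f y) (f y′)
          ... | inj₁ fy≤fy′ = z , z∈ , s+δ≤z , ≤-trans fz≤fy fy≤fy′
          ... | inj₂ fy′≤fy with Qx y′ y′∈
          ...   | z′ , z′∈ , x≤z′ , fz′≤fy′ = z′ , z′∈ ,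
            far z′ z′∈ (≤-trans (<⇒≤ s-δ<x) x≤z′) (≤-trans fz′≤fy′ fy′≤fy) , fz′≤fy′
        none : ¬ (∀ x → Q x → x ≤ s - δ)
        none h = <⇒≱ 0<δ (linear (least (s - δ) h)
          (solve 2 (λ s δ → :0 :- δ := (s :- δ) :- s) refl _ _))

-- Riemann integrability of functions of bounded variation.

module Integration (em : ExcludedMiddle 0ℓ) (R : RealField) where
  open RealField R
  open Analysis R
  open FieldSolver R
  open OrderedField em R

  Antitone : (Carrier → Carrier) → Set
  Antitone k = ∀ {x y} → x ≤ y → k y ≤ k x

  module _ (k : Carrier → Carrier) (anti : Antitone k) where

    -- Lower Darboux sums of `k` over subdivisions of [-1, x]: as `k` is antitone, its infimum on a
    -- cell is the value at the right end.
    data LowerSum : Carrier → Carrier → Set where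
      start  : LowerSum (- 1#) 0#
      extend : ∀ {a b v} → LowerSum a v → a ≤ b → LowerSum b (v + (b - a) * k b)

    private
      lowerSum-bound : ∀ {x v} → LowerSum x v → - 1# ≤ x × v ≤ (x - - 1#) * k (- 1#)
      lowerSum-bound start = ≤-refl , ≤-reflexive
            (solve 2 (λ a k → :0 := (a :- a) :* k) refl (- 1#) _)
      lowerSum-bound (extend {a} {b} P a≤b) with lowerSum-bound P
      ... | -1≤a , bound = ≤-trans -1≤a a≤b ,
        linear (bound ⊕ *-monoʳ-≤ (0≤y-x a≤b) (anti (≤-trans -1≤a a≤b)))
          (solve 6 (λ a b v o kb ko →
              (b :- o) :* ko :- (v :+ (b :- a) :* kb) :=
              ((a :- o) :* ko :+ (b :- a) :* ko) :- (v :+ (b :- a) :* kb))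
            refl _ _ _ _ _ _)

      -- Right of `c` the values of `k` are at most `k c`, and subdividing a cell at `c` does not
      -- lower the sum.
      truncate : ∀ {x v c} → LowerSum x v → - 1# ≤ c → c ≤ x →
        ∃ λ u → LowerSum c u × v ≤ u + (x - c) * k c
      truncate {c = c} start -1≤c c≤-1 with ≤-antisym c≤-1 -1≤c
      ... | refl = 0# , start , ≤-reflexive
            (solve 2 (λ a k → :0 := :0 :+ (a :- a) :* k) refl (- 1#) _)
      truncate {c = c} (extend {a} {b} {v} P a≤b) -1≤c c≤b with ≤-total c a
      ... | inj₂ a≤c = v + (c - a) * k c , extend P a≤c ,
        linear (*-monoʳ-≤ (0≤y-x a≤b) (anti c≤b))
          (solve 6 (λ a b c v kb kc →
              (v :+ (c :- a) :* kc :+ (b :- c) :* kc) :- (v :+ (b :- a) :* kb) :=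
              (b :- a) :* kc :- (b :- a) :* kb)
            refl _ _ _ _ _ _)
      ... | inj₁ c≤a with truncate P -1≤c c≤a
      ...   | u , Q , bound = u , Q ,
        linear (bound ⊕ *-monoʳ-≤ (0≤y-x a≤b) (anti c≤b))
          (solve 7 (λ a b c u v kb kc →
              (u :+ (b :- c) :* kc) :- (v :+ (b :- a) :* kb) :=
              (u :+ (a :- c) :* kc :+ (b :- a) :* kc) :- (v :+ (b :- a) :* kb))
            refl _ _ _ _ _ _ _)

      IsPrimitiveAt : Carrier → Carrier → Set
      IsPrimitiveAt x s =
        (∀ v → LowerSum x v → v ≤ s) × (∀ b → (∀ v → LowerSum x v → v ≤ b) → s ≤ b)

      primitiveAt : ∀ x → ∃ λ s → - 1# ≤ x → IsPrimitiveAt x s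
      primitiveAt x with ≤⊎> (- 1#) x
      -- A default value: left of -1 there are no lower sums to take the supremum of.
      ... | inj₂ x<-1 = 0# , λ -1≤x → ⊥-elim (<⇒≱ x<-1 -1≤x)
      ... | inj₁ -1≤x with supremum (LowerSum x) (_ , extend start -1≤x) (_ , λ v P → proj₂ (lowerSum-bound P))
      ...   | s , isSup = s , λ _ → isSup

    -- `J` is the lower integral from -1. The first bound appends the cell [a, b] to a subdivision
    -- of [-1, a]; the second truncates a subdivision of [-1, b] at `a`.
    antitone-primitive : ∃ λ J → ∀ {a b} → - 1# ≤ a → a ≤ b →
      J a + (b - a) * k b ≤ J b × J b ≤ J a + (b - a) * k a
    antitone-primitive = (λ x → proj₁ (primitiveAt x)) , λ {a} {b} -1≤a a≤b →
      let upperᵃ , leastᵃ = proj₂ (primitiveAt a) -1≤a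
          upperᵇ , leastᵇ = proj₂ (primitiveAt b) (≤-trans -1≤a a≤b)
      in linear
           (leastᵃ (proj₁ (primitiveAt b) - (b - a) * k b) λ v P →
             linear (upperᵇ _ (extend P a≤b))
               (solve 3 (λ J t v → J :- t :- v := J :- (v :+ t)) refl _ _ _))
           (solve 3 (λ J t v → J :- (v :+ t) := J :- t :- v) refl _ _ _)
       , leastᵇ _ λ v P → let u , Q , bound = truncate P -1≤a a≤b in
           ≤-trans bound (upperᵃ u Q ⊕ ≤-refl)

  -- J is a primitive of f on [-1, 1], up to an error on each cell that is
  -- controlled by the oscillation of an antitone function.
  record HasPrimitive (f : Carrier → Carrier) : Set where
    field
      J osc : Carrier → Carrier
      osc-antitone : Antitone osc
      cell-error : ∀ {a τ b} → - 1# ≤ a → a ≤ τ → τ ≤ b → InSeed τ →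
        ∣ (b - a) * f τ - (J b - J a) ∣ ≤ (b - a) * (osc a - osc b)

  0∈seeds : InSeed 0#
  0∈seeds = ≰⇒> (λ p → <⇒≱ 0<1 (linear p (solve 0 (:0 :- :1 := :- :1 :- :0) refl))) , 0<1

  module _ (k : Carrier → Carrier) {lo hi : Carrier}
    (anti : ∀ {r s} → InSeed r → InSeed s → r ≤ s → k s ≤ k r)
    (lo≤k : ∀ {r} → InSeed r → lo ≤ k r) (k≤hi : ∀ {r} → InSeed r → k r ≤ hi) where

    private
      lo≤hi : lo ≤ hi
      lo≤hi = ≤-trans (lo≤k 0∈seeds) (k≤hi 0∈seeds)

      -- The seeds form an open interval, but the cells of a partition reach its endpoints.
      -- Continuing `k` by its upper bound on the left and its lower bound on the right keeps it
      -- antitone.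
      record Extension (r y : Carrier) : Set where
        field
          inside : InSeed r → y ≡ k r
          left   : r ≤ - 1# → y ≡ hi
          right  : 1# ≤ r → y ≡ lo
          lower  : lo ≤ y
          upper  : y ≤ hi

      extension : ∀ r → ∃ (Extension r)
      extension r with ≤⊎> r (- 1#) | ≤⊎> 1# r
      ... | inj₁ r≤-1 | inj₁ 1≤r = ⊥-elim (<⇒≱ (proj₁ 0∈seeds) (≤-trans 0≤1 (≤-trans 1≤r r≤-1)))
      ... | inj₁ r≤-1 | inj₂ r<1 = hi , record
        { inside = λ r∈ → ⊥-elim (<⇒≱ (proj₁ r∈) r≤-1)
        ; left   = λ _ → refl
        ; right  = λ 1≤r → ⊥-elim (<⇒≱ r<1 1≤r)
        ; lower  = lo≤hi
        ; upper  = ≤-refl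
        }
      ... | inj₂ -1<r | inj₁ 1≤r = lo , record
        { inside = λ r∈ → ⊥-elim (<⇒≱ (proj₂ r∈) 1≤r)
        ; left   = λ r≤-1 → ⊥-elim (<⇒≱ -1<r r≤-1)
        ; right  = λ _ → refl
        ; lower  = ≤-refl
        ; upper  = lo≤hi
        }
      ... | inj₂ -1<r | inj₂ r<1 = k r , record
        { inside = λ _ → refl
        ; left   = λ r≤-1 → ⊥-elim (<⇒≱ -1<r r≤-1)
        ; right  = λ 1≤r → ⊥-elim (<⇒≱ r<1 1≤r)
        ; lower  = lo≤k (-1<r , r<1)
        ; upper  = k≤hi (-1<r , r<1)
        }

      k̂ : Carrier → Carrier
      k̂ r = proj₁ (extension r)

      module K̂ r = Extension (proj₂ (extension r))

      k̂-antitone : Antitone k̂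
      k̂-antitone {r} {s} r≤s = cases (≤⊎> r (- 1#)) (≤⊎> 1# s)
        where
        cases : r ≤ - 1# ⊎ - 1# < r → 1# ≤ s ⊎ s < 1# → k̂ s ≤ k̂ r
        cases (inj₁ p) _        = ≤-trans (K̂.upper s) (≤-reflexive (sym (K̂.left r p)))
        cases (inj₂ _) (inj₁ p) = ≤-trans (≤-reflexive (K̂.right s p)) (K̂.lower r)
        cases (inj₂ p) (inj₂ q) = subst₂ _≤_ (sym (K̂.inside s s∈)) (sym (K̂.inside r r∈)) (anti r∈ s∈ r≤s)
          where
          r∈ = p , ≤-<-trans r≤s q
          s∈ = <-≤-trans p r≤s , q

    -- Both the increment of the primitive over a cell and `(b - a) * k τ` lie between
    -- `(b - a) * k̂ b` and `(b - a) * k̂ a`.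
    antitone⇒hasPrimitive : HasPrimitive k
    antitone⇒hasPrimitive = record
      { J = proj₁ J-exists
      ; osc = k̂
      ; osc-antitone = k̂-antitone
      ; cell-error = λ {a} {τ} {b} -1≤a a≤τ τ≤b τ∈ →
          let eq = K̂.inside τ τ∈
              a≤b = ≤-trans a≤τ τ≤b
              lower , upper = proj₂ J-exists -1≤a a≤b
              0≤b-a = 0≤y-x a≤b
          in ∣x-y∣-lub
               (linear (lower ⊕ *-monoʳ-≤ 0≤b-a (subst (_≤ k̂ a) eq (k̂-antitone a≤τ)))
                 (solve 6 (λ d k ka kb Ja Jb →
                     d :* (ka :- kb) :- (d :* k :- (Jb :- Ja)) :=
                           (Jb :+ d :* ka) :- (Ja :+ d :* kb :+ d :* k))
                   refl (b - a) _ _ _ _ _))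
               (linear (upper ⊕ *-monoʳ-≤ 0≤b-a (subst (k̂ b ≤_) eq (k̂-antitone τ≤b)))
                 (solve 6 (λ d k ka kb Ja Jb →
                     d :* (ka :- kb) :- ((Jb :- Ja) :- d :* k) :=
                           (Ja :+ d :* ka :+ d :* k) :- (Jb :+ d :* kb))
                   refl (b - a) _ _ _ _ _))
      }
      where
      J-exists = antitone-primitive k̂ k̂-antitone

  hasPrimitive-difference : ∀ {f g h} → (∀ {r} → InSeed r → h r ≡ f r - g r) →
    HasPrimitive f → HasPrimitive g → HasPrimitive h
  hasPrimitive-difference {f} {g} {h} h≡f-g P Q = record
    { J = λ x → P.J x - Q.J x
    ; osc = λ x → P.osc x + Q.osc x
    ; osc-antitone = λ x≤y → P.osc-antitone x≤y ⊕ Q.osc-antitone x≤y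
    ; cell-error = λ {a} {τ} {b} -1≤a a≤τ τ≤b τ∈ →
        let p = P.cell-error -1≤a a≤τ τ≤b τ∈
            q = Q.cell-error -1≤a a≤τ τ≤b τ∈
        in subst (λ y → ∣ (b - a) * y - (P.J b - Q.J b - (P.J a - Q.J a)) ∣ ≤ _) (sym (h≡f-g τ∈))
          (∣x-y∣-lub
            (linear (≤-trans x≤∣x∣ p ⊕ ≤-trans ∣x-y∣≥y-x q)
              (solve 11 (λ d f g Pa Pb Qa Qb pa pb qa qb →
                  d :* ((pa :+ qa) :- (pb :+ qb))
                        :- (d :* (f :- g) :- ((Pb :- Qb) :- (Pa :- Qa))) :=
                  (d :* (pa :- pb) :+ d :* (qa :- qb))
                        :- ((d :* f :- (Pb :- Pa)) :+ ((Qb :- Qa) :- d :* g)))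
                refl (b - a) _ _ _ _ _ _ _ _ _ _))
            (linear (≤-trans ∣x-y∣≥y-x p ⊕ ≤-trans x≤∣x∣ q)
              (solve 11 (λ d f g Pa Pb Qa Qb pa pb qa qb →
                  d :* ((pa :+ qa) :- (pb :+ qb))
                        :- (((Pb :- Qb) :- (Pa :- Qa)) :- d :* (f :- g)) :=
                  (d :* (pa :- pb) :+ d :* (qa :- qb))
                        :- (((Pb :- Pa) :- d :* f) :+ (d :* g :- (Qb :- Qa))))
                refl (b - a) _ _ _ _ _ _ _ _ _ _)))
    }
    where
    module P = HasPrimitive P
    module Q = HasPrimitive Q

  -- Once each cell width is replaced by `δ`, the cell errors telescope to
  -- `δ * (osc (- 1#) - osc 1#)`, whatever the partition and its tags.
  hasPrimitive⇒expectation : ∀ {f} → HasPrimitive f → ∃ (IsExpectation f)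
  hasPrimitive⇒expectation {f} P = 2# ⁻¹ * (J 1# - J (- 1#)) , λ ε 0<ε →
    Ω⁺ ⁻¹ * ε , *-positive (⁻¹-positive 0<Ω⁺) 0<ε , λ s S →
    ∣x-y∣-lub (scaled (half-≤ (error≤ε 0<ε (≤-trans x≤∣x∣ (sum-error ≤-refl S)))) (<⇒≤ 0<ε))
              (scaled (half-≤ (error≤ε 0<ε (≤-trans ∣x-y∣≥y-x (sum-error ≤-refl S)))) (<⇒≤ 0<ε))
    where
    open HasPrimitive P

    sum-error : ∀ {δ a b s} → - 1# ≤ a → RiemannSum f δ a b s →
      ∣ s - (J b - J a) ∣ ≤ δ * (osc a - osc b)
    sum-error {δ} {a} -1≤a empty = ∣x-y∣-lub
      (≤-reflexive (solve 3 (λ J δ o → :0 :- (J :- J) := δ :* (o :- o)) refl (J a) δ (osc a)))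
      (≤-reflexive (solve 3 (λ J δ o → (J :- J) :- :0 := δ :* (o :- o)) refl (J a) δ (osc a)))
    sum-error {δ} {a} {b} -1≤a (cell {m = m} τ a≤τ τ≤m τ∈ m-a≤δ S) = ∣x-y∣-lub
      (linear (≤-trans x≤∣x∣ tail ⊕ ≤-trans x≤∣x∣ head ⊕ scale)
        (solve 10 (λ d δ f s Ja Jm Jb oa om ob →
            δ :* (oa :- ob) :- ((d :* f :+ s) :- (Jb :- Ja)) :=
            (δ :* (om :- ob) :+ (d :* (oa :- om) :+ δ :* (oa :- om))) :-
            ((s :- (Jb :- Jm)) :+ ((d :* f :- (Jm :- Ja)) :+ d :* (oa :- om))))
          refl (m - a) _ _ _ _ _ _ _ _ _))
      (linear (≤-trans ∣x-y∣≥y-x tail ⊕ ≤-trans ∣x-y∣≥y-x head ⊕ scale)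
        (solve 10 (λ d δ f s Ja Jm Jb oa om ob →
            δ :* (oa :- ob) :- ((Jb :- Ja) :- (d :* f :+ s)) :=
            (δ :* (om :- ob) :+ (d :* (oa :- om) :+ δ :* (oa :- om))) :-
            (((Jb :- Jm) :- s) :+ (((Jm :- Ja) :- d :* f) :+ d :* (oa :- om))))
          refl (m - a) _ _ _ _ _ _ _ _ _))
      where
      a≤m = ≤-trans a≤τ τ≤m
      tail = sum-error (≤-trans -1≤a a≤m) S
      head = cell-error -1≤a a≤τ τ≤m τ∈
      scale : (m - a) * (osc a - osc m) ≤ δ * (osc a - osc m)
      scale = *-monoˡ-≤ (0≤y-x (osc-antitone a≤m)) m-a≤δ

    -- The total oscillation, increased by `1#` so that it can be divided by even when `osc` is
    -- constant.
    Ω⁺ : Carrier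
    Ω⁺ = (osc (- 1#) - osc 1#) + 1#
    0<Ω⁺ : 0# < Ω⁺
    0<Ω⁺ = +-positive (0≤y-x (osc-antitone (≤-trans (<⇒≤ (proj₁ 0∈seeds)) 0≤1))) 0<1

    error≤ε : ∀ {ε x} → 0# < ε → x ≤ Ω⁺ ⁻¹ * ε * (osc (- 1#) - osc 1#) → x ≤ ε
    error≤ε {ε} 0<ε p = linear (p ⊕ ≤-reflexive (*-inverse-cancel {x = ε} 0<Ω⁺)
          ⊕ *-nonNegative (⁻¹-nonNegative 0<Ω⁺) (<⇒≤ 0<ε))
      (solve 5 (λ x i ε oa ob → ε :- x :=
          (i :* ε :* (oa :- ob) :+ (ε :+ i :* ε)) :- (x :+ (((oa :- ob) :+ :1) :* (i :* ε) :+ :0)))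
        refl _ _ _ _ _)

    half-≤ : ∀ {x y} → x ≤ y → 2# ⁻¹ * x ≤ 2# ⁻¹ * y
    half-≤ = *-monoʳ-≤ (⁻¹-nonNegative 0<2)

    scaled : ∀ {x y ε} → 2# ⁻¹ * (x - y) ≤ 2# ⁻¹ * ε → 0# ≤ ε → 2# ⁻¹ * x - 2# ⁻¹ * y ≤ ε
    scaled {ε = ε} p 0≤ε = linear (p ⊕ ≤-reflexive (half ε)
          ⊕ *-nonNegative (⁻¹-nonNegative 0<2) 0≤ε)
      (solve 4 (λ h x y ε → ε :- (h :* x :- h :* y) :=
          (h :* ε :+ (ε :+ h :* ε)) :- (h :* (x :- y) :+ (h :* ε :+ h :* ε :+ :0)))
        refl _ _ _ _)

  -- A function whose variation is controlled by a bounded antitone function g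
  -- is the difference of the antitone functions f + g and g.
  record BoundedVariation (f : Carrier → Carrier) : Set where
    field
      g : Carrier → Carrier
      bound : Carrier
      g-nonNegative : ∀ {r} → InSeed r → 0# ≤ g r
      g-bounded : ∀ {r} → InSeed r → g r ≤ bound
      variation : ∀ {r s} → InSeed r → InSeed s → r ≤ s → ∣ f r - f s ∣ ≤ g r - g s

  -- The variation estimate makes `f + g` antitone and, applied against the seed 0, also bounds it,
  -- as the extension to the endpoints requires.
  boundedVariation⇒expectation : ∀ {f} → BoundedVariation f → ∃ (IsExpectation f)
  boundedVariation⇒expectation {f} V = hasPrimitive⇒expectation
    (hasPrimitive-difference (λ _ → solve 2 (λ f g → f := f :+ g :- g) refl _ _)
      (antitone⇒hasPrimitive (λ r → f r + g r)
        (λ r∈ s∈ r≤s → linear (≤-trans ∣x-y∣≥y-x (variation r∈ s∈ r≤s))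
          (solve 4 (λ fr fs gr gs → (fr :+ gr) :- (fs :+ gs) := (gr :- gs) :- (fs :- fr))
                refl _ _ _ _))
        (λ r∈ → linear (near r∈ ⊕ g-nonNegative r∈)
          (solve 4 (λ f f₀ g b → (f :+ g) :- (f₀ :- b) := (b :+ g) :- ((f₀ :- f) :+ :0))
                refl _ _ _ _))
        (λ r∈ → linear (near′ r∈ ⊕ g-bounded r∈)
          (solve 4 (λ f f₀ g b → (f₀ :+ b :+ b) :- (f :+ g) := (b :+ b) :- ((f :- f₀) :+ g))
                refl _ _ _ _)))
      (antitone⇒hasPrimitive g
        (λ r∈ s∈ r≤s → linear (≤-trans 0≤∣x∣ (variation r∈ s∈ r≤s))
          (solve 2 (λ gr gs → gr :- gs := gr :- gs :- :0) refl _ _))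
        g-nonNegative g-bounded))
    where
    open BoundedVariation V
    near∣∣ : ∀ {r} → InSeed r → ∣ f 0# - f r ∣ ≤ bound
    near∣∣ {r} r∈ with ≤-total 0# r
    ... | inj₁ 0≤r = ≤-trans (variation 0∈seeds r∈ 0≤r)
          (linear (g-bounded 0∈seeds ⊕ g-nonNegative r∈)
      (solve 3 (λ a b c → c :- (a :- b) := (c :+ b) :- (a :+ :0)) refl _ _ _))
    ... | inj₂ r≤0 = ≤-trans ∣x-y∣-swap
          (≤-trans (variation r∈ 0∈seeds r≤0) (linear (g-bounded r∈ ⊕ g-nonNegative 0∈seeds)
      (solve 3 (λ a b c → c :- (a :- b) := (c :+ b) :- (a :+ :0)) refl _ _ _)))
    near : ∀ {r} → InSeed r → f 0# - f r ≤ bound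
    near r∈ = ≤-trans x≤∣x∣ (near∣∣ r∈)
    near′ : ∀ {r} → InSeed r → f r - f 0# ≤ bound
    near′ r∈ = ≤-trans ∣x-y∣≥y-x (near∣∣ r∈)

-- Finite sums and the discrete movement estimate.

module FiniteSums (em : ExcludedMiddle 0ℓ) (R : RealField) where
  open RealField R
  open FieldSolver R
  open OrderedField em R

  ∑-mono : ∀ n {f g} → (∀ i → i ℕ.< n → f i ≤ g i) → ∑[ n ] f ≤ ∑[ n ] g
  ∑-mono zero    f≤g = ≤-refl
  ∑-mono (suc n) f≤g = ∑-mono n (λ i i<n → f≤g i (ℕ.m≤n⇒m≤1+n i<n)) ⊕ f≤g n ℕ.≤-refl

  ∑-cong : ∀ n {f g} → (∀ i → f i ≡ g i) → ∑[ n ] f ≡ ∑[ n ] g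
  ∑-cong zero    f≡g = refl
  ∑-cong (suc n) f≡g = cong₂ _+_ (∑-cong n f≡g) (f≡g n)

  ∑-0 : ∀ n → ∑[ n ] (λ _ → 0#) ≡ 0#
  ∑-0 zero    = refl
  ∑-0 (suc n) = trans (cong (_+ 0#) (∑-0 n)) (solve 0 (:0 :+ :0 := :0) refl)

  ∑-const : ∀ n x → ∑[ n ] (λ _ → x) ≡ fromℕ n * x
  ∑-const zero    x = solve 1 (λ x → :0 := :0 :* x) refl x
  ∑-const (suc n) x = trans (cong (_+ x) (∑-const n x))
    (solve 2 (λ n x → n :* x :+ x := (:1 :+ n) :* x) refl _ _)

  ∑-+ : ∀ n f g → ∑[ n ] (λ i → f i + g i) ≡ ∑[ n ] f + ∑[ n ] g
  ∑-+ zero    f g = solve 0 (:0 := :0 :+ :0) refl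
  ∑-+ (suc n) f g = trans (cong (_+ (f n + g n)) (∑-+ n f g))
    (solve 4 (λ a b c d → (a :+ b) :+ (c :+ d) := (a :+ c) :+ (b :+ d)) refl _ _ _ _)

  ∑-*ˡ : ∀ n a f → ∑[ n ] (λ i → a * f i) ≡ a * ∑[ n ] f
  ∑-*ˡ zero    a f = sym *-zeroʳ
  ∑-*ˡ (suc n) a f = trans (cong (_+ a * f n) (∑-*ˡ n a f))
    (solve 3 (λ a s f → a :* s :+ a :* f := a :* (s :+ f)) refl _ _ _)

  ∑-swap : ∀ m n (f : ℕ → ℕ → Carrier) →
    ∑[ m ] (λ i → ∑[ n ] (f i)) ≡ ∑[ n ] (λ j → ∑[ m ] (λ i → f i j))
  ∑-swap zero    n f = sym (∑-0 n)
  ∑-swap (suc m) n f = trans (cong (_+ ∑[ n ] (f m)) (∑-swap m n f)) (sym (∑-+ n _ _))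

  ∑-telescope : ∀ n (f : ℕ → Carrier) → ∑[ n ] (λ i → f (suc i) - f i) ≡ f n - f 0
  ∑-telescope zero    f = solve 1 (λ x → :0 := x :- x) refl _
  ∑-telescope (suc n) f = trans (cong (_+ (f (suc n) - f n)) (∑-telescope n f))
    (solve 3 (λ a b c → (b :- c) :+ (a :- b) := a :- c) refl _ _ _)

  fromℕ-mono-≤ : ∀ {m n} → m ℕ.≤ n → fromℕ m ≤ fromℕ n
  fromℕ-mono-≤ {n = n} ℕ.z≤n = fromℕ-nonNegative n
  fromℕ-mono-≤ (ℕ.s≤s m≤n)   = +-monoʳ-≤ 1# (fromℕ-mono-≤ m≤n)

  -- The sequences p and q stand for the actions before and after a cost function
  -- with minimum at z, along decreasing seeds; D is the change in potential.
  -- Towards z the distance covered is the slope of D, so that D first decreases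
  -- and then increases.
  grid-movement : ∀ k {p q D : ℕ → Carrier} {c z W} → 0# ≤ c →
    (∀ i → i ℕ.< k → p i ≤ p (suc i)) →
    (∀ i → i ℕ.< k → q i ≤ q (suc i)) →
    (∀ i → i ℕ.≤ k → 0# ≤ p i × p i ≤ W) →
    (∀ i → i ℕ.≤ k → 0# ≤ q i × q i ≤ W) →
    (∀ i → i ℕ.≤ k → 0# ≤ D i) →
    (∀ i → i ℕ.< k → p i ≤ z → p i ≤ q (suc i)) →
    (∀ i → i ℕ.< k → z < p (suc i) → q i ≤ p (suc i)) →
    (∀ i → i ℕ.< k → c * (q i - p (suc i)) ≤ D i - D (suc i)) →
    (∀ i → i ℕ.< k → c * (p i - q (suc i)) ≤ D (suc i) - D i) →
    ∑[ suc k ] (λ i → c * ∣ q i - p i ∣) ≤ D 0 + D k + (2# + 2# + 1#) * c * W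
  grid-movement k {p} {q} {D} {c} {z} {W} 0≤c p↗ q↗ p∈ q∈ 0≤D up down D↘ D↗ =
    -- The invariant sums the distances up to index `k - 1`, since each of them involves the next
    -- grid point. As `p` and `q` stay in [0, W], `err k` is at most `4 c W`; the distance at index
    -- `k` adds `c W`, whence the factor five.
    linear (proj₁ (invariant k ℕ.≤-refl)
            ⊕ *-monoʳ-≤ 0≤c
                  (proj₂ (p∈ k ℕ.≤-refl) ⊕ proj₁ (p∈ 0 ℕ.z≤n) ⊕ proj₂ (q∈ k ℕ.≤-refl)
                  ⊕ proj₁ (q∈ 0 ℕ.z≤n))
            ⊕ *-monoʳ-≤ 0≤c
                  (proj₂ (p∈ k ℕ.≤-refl) ⊕ proj₁ (p∈ 0 ℕ.z≤n) ⊕ proj₂ (q∈ k ℕ.≤-refl)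
                  ⊕ proj₁ (q∈ 0 ℕ.z≤n))
            ⊕ *-monoʳ-≤ 0≤c last)
      (solve 10 (λ D₀ Dₖ c W S a p₀ pₖ q₀ qₖ →
          let x = c :* (W :+ (p₀ :+ (W :+ q₀)))
              y = c :* (pₖ :+ (:0 :+ (qₖ :+ :0))) in
          D₀ :+ Dₖ :+ ((:1 :+ :1) :+ (:1 :+ :1) :+ :1) :* c :* W :- (S :+ c :* a) :=
          ((D₀ :+ Dₖ) :+ c :* ((:1 :+ :1) :* ((pₖ :- p₀) :+ (qₖ :- q₀))) :+ (x :+ (x :+ c :* W))) :-
          (S :+ (y :+ (y :+ c :* a))))
        refl _ _ _ _ _ _ _ _ _ _)
    where
    S err : ℕ → Carrier
    S j = ∑[ j ] (λ i → c * ∣ q i - p i ∣)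
    err j = c * (2# * ((p j - p 0) + (q j - q 0)))

    last : ∣ q k - p k ∣ ≤ W
    last = ∣x-y∣-lub
      (linear (proj₂ (q∈ k ℕ.≤-refl) ⊕ proj₁ (p∈ k ℕ.≤-refl))
            (solve 3 (λ p q W → W :- (q :- p) := (W :+ p) :- (q :+ :0)) refl _ _ _))
      (linear (proj₂ (p∈ k ℕ.≤-refl) ⊕ proj₁ (q∈ k ℕ.≤-refl))
            (solve 3 (λ p q W → W :- (p :- q) := (W :+ q) :- (p :+ :0)) refl _ _ _))

    -- Only neighbouring indices can be compared. The shift is absorbed by the increments of `p` and
    -- `q`, which accumulate to `err`.
    rising : ∀ j → j ℕ.< k → p j ≤ q (suc j) →
      ∣ q j - p j ∣ ≤ (q j - p (suc j)) + 2# * ((p (suc j) - p j) + (q (suc j) - q j))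
    rising j j<k pⱼ≤qⱼ₊₁ = ∣x-y∣-lub
      (linear (p↗ j j<k ⊕ q↗ j j<k ⊕ q↗ j j<k)
        (solve 4 (λ p p′ q q′ → (q :- p′) :+ (:1 :+ :1) :* ((p′ :- p) :+ (q′ :- q)) :- (q :- p) :=
            (p′ :+ (q′ :+ q′)) :- (p :+ (q :+ q))) refl (p j) (p (suc j)) (q j) (q (suc j))))
      (linear (p↗ j j<k ⊕ pⱼ≤qⱼ₊₁ ⊕ pⱼ≤qⱼ₊₁)
        (solve 4 (λ p p′ q q′ → (q :- p′) :+ (:1 :+ :1) :* ((p′ :- p) :+ (q′ :- q)) :- (p :- q) :=
            (p′ :+ (q′ :+ q′)) :- (p :+ (p :+ p))) refl (p j) (p (suc j)) (q j) (q (suc j))))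

    falling : ∀ j → j ℕ.< k → q j ≤ p (suc j) →
      ∣ q j - p j ∣ ≤ (p j - q (suc j)) + 2# * ((p (suc j) - p j) + (q (suc j) - q j))
    falling j j<k qⱼ≤pⱼ₊₁ = ∣x-y∣-lub
      (linear (q↗ j j<k ⊕ qⱼ≤pⱼ₊₁ ⊕ qⱼ≤pⱼ₊₁)
        (solve 4 (λ p p′ q q′ → (p :- q′) :+ (:1 :+ :1) :* ((p′ :- p) :+ (q′ :- q)) :- (q :- p) :=
            (q′ :+ (p′ :+ p′)) :- (q :+ (q :+ q))) refl (p j) (p (suc j)) (q j) (q (suc j))))
      (linear (q↗ j j<k ⊕ p↗ j j<k ⊕ p↗ j j<k)
        (solve 4 (λ p p′ q q′ → (p :- q′) :+ (:1 :+ :1) :* ((p′ :- p) :+ (q′ :- q)) :- (p :- q) :=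
            (q′ :+ (p′ :+ p′)) :- (q :+ (p :+ p))) refl (p j) (p (suc j)) (q j) (q (suc j))))

    -- Until `p` passes `z`, the fall of `D` pays for the distance, which is the second bound. Since
    -- `0 ≤ D`, it implies the first one, which is preserved after the turning point, where the rise
    -- of `D` pays.
    invariant : ∀ j → j ℕ.≤ k →
      S j ≤ D 0 + D j + err j × (p j ≤ z → S j ≤ D 0 - D j + err j)
    invariant zero    0≤k =
      linear (0≤D 0 0≤k ⊕ 0≤D 0 0≤k)
        (solve 4 (λ D c p q → D :+ D :+ c :* ((:1 :+ :1) :* ((p :- p) :+ (q :- q))) :- :0 :=
              D :+ D :- (:0 :+ :0))
          refl _ _ _ _) ,
      λ _ → ≤-reflexive
        (solve 4 (λ D c p q → :0 := D :- D :+ c :* ((:1 :+ :1) :* ((p :- p) :+ (q :- q))))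
              refl _ _ _ _)
    invariant (suc j) j<k with invariant j (ℕ.<⇒≤ j<k) | ≤⊎> (p (suc j)) z
    ... | general , decreasing | inj₁ pⱼ₊₁≤z = linear (bound ⊕ 0≤D (suc j) j<k ⊕ 0≤D (suc j) j<k)
          (solve 4 (λ S D₀ D e → D₀ :+ D :+ e :- S :=
                (D₀ :- D :+ e) :+ (D :+ D) :- (S :+ (:0 :+ :0))) refl _ _ _ _)
        , λ _ → bound
      where
      pⱼ≤z : p j ≤ z
      pⱼ≤z = ≤-trans (p↗ j j<k) pⱼ₊₁≤z
      bound : S (suc j) ≤ D 0 - D (suc j) + err (suc j)
      bound = linear (decreasing pⱼ≤z ⊕ D↘ j j<k ⊕ *-monoʳ-≤ 0≤c (rising j j<k (up j j<k pⱼ≤z)))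
        (solve 12 (λ S a D₀ D D′ c p p′ p₀ q q′ q₀ →
            (D₀ :- D′ :+ c :* ((:1 :+ :1) :* ((p′ :- p₀) :+ (q′ :- q₀)))) :- (S :+ c :* a) :=
            ((D₀ :- D :+ c :* ((:1 :+ :1) :* ((p :- p₀) :+ (q :- q₀)))) :+
              ((D :- D′) :+ c :* ((q :- p′) :+ (:1 :+ :1) :* ((p′ :- p) :+ (q′ :- q))))) :-
            (S :+ (c :* (q :- p′) :+ c :* a)))
          refl (S j) _ (D 0) (D j) (D (suc j)) c (p j) (p (suc j)) (p 0) (q j) (q (suc j)) (q 0))
    ... | general , _ | inj₂ z<pⱼ₊₁ = bound , λ pⱼ₊₁≤z → ⊥-elim (<⇒≱ z<pⱼ₊₁ pⱼ₊₁≤z)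
      where
      bound : S (suc j) ≤ D 0 + D (suc j) + err (suc j)
      bound = linear (general ⊕ D↗ j j<k ⊕ *-monoʳ-≤ 0≤c (falling j j<k (down j j<k z<pⱼ₊₁)))
        (solve 12 (λ S a D₀ D D′ c p p′ p₀ q q′ q₀ →
            (D₀ :+ D′ :+ c :* ((:1 :+ :1) :* ((p′ :- p₀) :+ (q′ :- q₀)))) :- (S :+ c :* a) :=
            ((D₀ :+ D :+ c :* ((:1 :+ :1) :* ((p :- p₀) :+ (q :- q₀)))) :+
              ((D′ :- D) :+ c :* ((p :- q′) :+ (:1 :+ :1) :* ((p′ :- p) :+ (q′ :- q))))) :-
            (S :+ (c :* (p :- q′) :+ c :* a)))
          refl (S j) _ (D 0) (D j) (D (suc j)) c (p j) (p (suc j)) (p 0) (q j) (q (suc j)) (q 0))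

-- Averages over uniform grids of seeds.

module Midpoints (em : ExcludedMiddle 0ℓ) (R : RealField) where
  open RealField R
  open Analysis R
  open FieldSolver R
  open OrderedField em R
  open Integration em R
  open FiniteSums em R

  -- Half the length of a cell, and at the same time the weight of one midpoint in the average.
  width : ℕ → Carrier
  width k = fromℕ (suc k) ⁻¹

  -- The midpoints of the subdivision of [-1, 1] into suc k equal cells, in
  -- decreasing order.
  midpoint : ℕ → ℕ → Carrier
  midpoint k i = 1# - (2# * fromℕ i + 1#) * width k

  average : ℕ → (Carrier → Carrier) → Carrier
  average k f = width k * ∑[ suc k ] (λ i → f (midpoint k i))

  width-inverse : ∀ k → fromℕ (suc k) * width k ≡ 1#
  width-inverse k = *-inverse (fromℕ-positive k)

  0<width : ∀ k → 0# < width k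
  0<width k = ⁻¹-positive (fromℕ-positive k)

  0≤width : ∀ k → 0# ≤ width k
  0≤width k = <⇒≤ (0<width k)

  midpoint-step : ∀ k i → midpoint k i - midpoint k (suc i) ≡ 2# * width k
  midpoint-step k i = solve 2 (λ n w →
      (:1 :- ((:1 :+ :1) :* n :+ :1) :* w) :- (:1 :- ((:1 :+ :1) :* (:1 :+ n) :+ :1) :* w) :=
            (:1 :+ :1) :* w)
    refl (fromℕ i) (width k)

  midpoint∈seeds : ∀ {k i} → i ℕ.≤ k → InSeed (midpoint k i)
  midpoint∈seeds {k} {i} i≤k =
    ≰⇒> (λ p → <⇒≱ (0<width k)
      (linear (p ⊕ ≤-reflexive (width-inverse k) ⊕ ≤-reflexive (width-inverse k)
               ⊕ *-monoˡ-≤ (0≤width k) (fromℕ-mono-≤ i≤k)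
                     ⊕ *-monoˡ-≤ (0≤width k) (fromℕ-mono-≤ i≤k))
        (solve 3 (λ i k w → :0 :- w :=
            (:- :1 :+ (:1 :+ (:1 :+ (k :* w :+ k :* w)))) :-
            ((:1 :- ((:1 :+ :1) :* i :+ :1) :* w) :+
              ((:1 :+ k) :* w :+ ((:1 :+ k) :* w :+ (i :* w :+ i :* w)))))
          refl (fromℕ i) (fromℕ k) (width k)))) ,
    ≰⇒> (λ p → <⇒≱ (0<width k)
      (linear (p ⊕ iw ⊕ iw)
        (solve 2 (λ i w → :0 :- w :=
              ((:1 :- ((:1 :+ :1) :* i :+ :1) :* w) :+ (i :* w :+ i :* w)) :- (:1 :+ (:0 :+ :0)))
          refl (fromℕ i) (width k))))
    where
    iw : 0# ≤ fromℕ i * width k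
    iw = *-nonNegative (fromℕ-nonNegative i) (0≤width k)

  midpoint-symmetric : ∀ k → midpoint k 0 + midpoint k k ≡ 0#
  midpoint-symmetric k = trans
    (solve 2 (λ k w →
        (:1 :- ((:1 :+ :1) :* :0 :+ :1) :* w) :+ (:1 :- ((:1 :+ :1) :* k :+ :1) :* w) :=
        (:1 :+ :1) :- (:1 :+ :1) :* ((:1 :+ k) :* w)) refl (fromℕ k) (width k))
    (trans (cong (λ x → 2# - 2# * x) (width-inverse k))
          (solve 0 ((:1 :+ :1) :- (:1 :+ :1) :* :1 := :0) refl))

  private
    ∑-midpoint : ∀ k n → ∑[ n ] (midpoint k) ≡ fromℕ n * (1# - fromℕ n * width k)
    ∑-midpoint k zero    = solve 1 (λ x → :0 := :0 :* x) refl _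
    ∑-midpoint k (suc n) = trans (cong (_+ midpoint k n) (∑-midpoint k n))
      (solve 2 (λ n w → n :* (:1 :- n :* w) :+ (:1 :- ((:1 :+ :1) :* n :+ :1) :* w) :=
          (:1 :+ n) :* (:1 :- (:1 :+ n) :* w)) refl (fromℕ n) (width k))

  average-mono : ∀ k {f g} → (∀ {r} → InSeed r → f r ≤ g r) → average k f ≤ average k g
  average-mono k f≤g = *-monoʳ-≤
        (0≤width k) (∑-mono (suc k) λ i i≤k → f≤g (midpoint∈seeds (ℕ.s≤s⁻¹ i≤k)))

  average-+ : ∀ k f g → average k (λ r → f r + g r) ≡ average k f + average k g
  average-+ k f g = trans (cong (width k *_) (∑-+ (suc k) _ _))
    (solve 3 (λ w x y → w :* (x :+ y) := w :* x :+ w :* y) refl _ _ _)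

  average-* : ∀ k a f → average k (λ r → a * f r) ≡ a * average k f
  average-* k a f = trans (cong (width k *_) (∑-*ˡ (suc k) a _))
    (solve 3 (λ w a x → w :* (a :* x) := a :* (w :* x)) refl _ _ _)

  average-const : ∀ k x → average k (λ _ → x) ≡ x
  average-const k x = trans (cong (width k *_) (∑-const (suc k) x))
    (trans (solve 3 (λ w n x → w :* (n :* x) := n :* w :* x) refl _ _ _)
    (trans (cong (_* x) (width-inverse k)) (solve 1 (λ x → :1 :* x := x) refl x)))

  -- The counterpart of 𝔼[r] = 0, exact on every grid, so the service estimate incurs no
  -- discretization error.
  average-id : ∀ k → average k (λ r → r) ≡ 0#
  average-id k = trans (cong (width k *_) (∑-midpoint k (suc k)))
    (trans (cong (λ x → width k * (fromℕ (suc k) * (1# - x))) (width-inverse k))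
    (solve 2 (λ w n → w :* (n :* (:1 :- :1)) := :0) refl _ _))

  module _ {f : Carrier → Carrier} {δ : Carrier} (k : ℕ) (2w≤δ : 2# * width k ≤ δ) where

    private
      -- The constructor `cell` adds a cell on the left, so the decreasing enumeration of the
      -- midpoints builds the partition from its right end.
      partial-sum : ∀ j → j ℕ.≤ suc k → ∃ λ s →
        RiemannSum f δ (1# - fromℕ j * (2# * width k)) 1# s ×
        s ≡ 2# * width k * ∑[ j ] (λ i → f (midpoint k i))
      partial-sum zero    _ = 0# ,
        subst (λ a → RiemannSum f δ a 1# 0#) (solve 1 (λ x → :1 := :1 :- :0 :* x) refl _) empty ,
        sym *-zeroʳ
      partial-sum (suc j) j<k with partial-sum j (ℕ.<⇒≤ j<k)
      ... | s , S , eq = _ , cell (midpoint k j)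
          (linear (0≤width k) (solve 2 (λ j w →
              (:1 :- ((:1 :+ :1) :* j :+ :1) :* w) :- (:1 :- (:1 :+ j) :* ((:1 :+ :1) :* w)) :=
                    w :- :0)
            refl (fromℕ j) (width k)))
          (linear (0≤width k) (solve 2 (λ j w →
              (:1 :- j :* ((:1 :+ :1) :* w)) :- (:1 :- ((:1 :+ :1) :* j :+ :1) :* w) := w :- :0)
            refl (fromℕ j) (width k)))
          (midpoint∈seeds (ℕ.s≤s⁻¹ j<k))
          (≤-trans (≤-reflexive step) 2w≤δ) S ,
        trans (cong₂ (λ x y → x * f (midpoint k j) + y) step eq)
          (solve 3 (λ w f s → w :* f :+ w :* s := w :* (s :+ f)) refl _ _ _)
        where
        step : (1# - fromℕ j * (2# * width k)) - (1# - fromℕ (suc j) * (2# * width k))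
              ≡ 2# * width k
        step = solve 2
              (λ j w → (:1 :- j :* w) :- (:1 :- (:1 :+ j) :* w) := w) refl (fromℕ j) (2# * width k)

    midpoint-riemannSum : RiemannSum f δ (- 1#) 1# (2# * average k f)
    midpoint-riemannSum = subst₂ (λ a s → RiemannSum f δ a 1# s) left
      (trans (proj₂ (proj₂ full))
            (solve 2 (λ w x → (:1 :+ :1) :* w :* x := (:1 :+ :1) :* (w :* x)) refl _ _))
      (proj₁ (proj₂ full))
      where
      full = partial-sum (suc k) ℕ.≤-refl
      left : 1# - fromℕ (suc k) * (2# * width k) ≡ - 1#
      left = trans
        (solve 2 (λ n w → :1 :- n :* ((:1 :+ :1) :* w) := :1 :- (:1 :+ :1) :* (n :* w))
          refl (fromℕ (suc k)) (width k))
        (trans (cong (λ x → 1# - 2# * x) (width-inverse k))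
          (solve 0 (:1 :- (:1 :+ :1) :* :1 := :- :1) refl))

  -- Twice the average is a Riemann sum, so the averages approach `e` while the error `b * width k`
  -- vanishes.
  expectation-≤ : ∀ {f e n a b} → IsExpectation f e → 0# ≤ n → 0# ≤ b →
    (∀ k → n * average k f ≤ a + b * width k) → n * e ≤ a
  expectation-≤ {f} {e} {n} {a} {b} E 0≤n 0≤b avg≤ = ≤-limit (linear (0≤n ⊕ 0≤b)
    (solve 2 (λ n b → (n :+ b) :- :0 := (n :+ b) :- (:0 :+ :0)) refl n b)) λ ε 0<ε →
    let δ , 0<δ , close = E ε 0<ε
        -- The bound by ε controls the error term; the bound by δ / 2 makes the cells, of length
        -- `2# * width k`, fine enough.
        h , h≤ε , h≤½δ , 0<h = min-positive 0<ε (*-positive (⁻¹-positive 0<2) 0<δ)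
        k , w≤h = small-reciprocal 0<h
        w≤½δ = ≤-trans w≤h h≤½δ
        2w≤δ : 2# * width k ≤ δ
        2w≤δ = linear (w≤½δ ⊕ w≤½δ ⊕ ≤-reflexive (half δ))
          (solve 3 (λ w x δ → δ :- (:1 :+ :1) :* w := (x :+ (x :+ δ)) :- (w :+ (w :+ (x :+ x))))
                refl _ _ _)
        e≤ : e - 2# ⁻¹ * (2# * average k f) ≤ ε
        e≤ = ≤-trans ∣x-y∣≥y-x (close _ (midpoint-riemannSum k 2w≤δ))
        e≤′ : e ≤ average k f + ε
        e≤′ = linear (e≤
              ⊕ ≤-reflexive (trans
              (solve 2 (λ h x → h :* ((:1 :+ :1) :* x) := h :* x :+ h :* x)
              refl _ _) (half (average k f))))
          (solve 4 (λ e x A ε → (A :+ ε) :- e := (ε :+ A) :- ((e :- x) :+ x)) refl _ _ _ _)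
    in linear (*-monoʳ-≤ 0≤n e≤′ ⊕ avg≤ k ⊕ *-monoʳ-≤ 0≤b (≤-trans w≤h h≤ε))
      (solve 7 (λ n e A ε a b w → (a :+ (n :+ b) :* ε) :- n :* e :=
          (n :* (A :+ ε) :+ (a :+ b :* w :+ b :* ε)) :- (n :* e :+ (n :* A :+ b :* w)))
        refl n e (average k f) ε a b (width k))
    where
    min-positive : ∀ {x y} → 0# < x → 0# < y → ∃ λ h → h ≤ x × h ≤ y × 0# < h
    min-positive {x} {y} 0<x 0<y with ≤-total x y
    ... | inj₁ x≤y = x , ≤-refl , x≤y , 0<x
    ... | inj₂ y≤x = y , y≤x , ≤-refl , 0<y

-- Norms on the line as multiples of the absolute value.

module Norms (em : ExcludedMiddle 0ℓ) (R : RealField) where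
  open RealField R
  open Analysis R
  open FieldSolver R
  open OrderedField em R

  module _ {ν : Carrier → Carrier} (isNorm : IsNorm ν) where
    open IsNorm isNorm

    norm≡∣∣ : ∀ x → ν x ≡ ν 1# * ∣ x ∣
    norm≡∣∣ x = trans (cong ν (solve 1 (λ x → x := x :* :1) refl x)) (trans (homogeneous x 1#)
      (solve 2 (λ a b → a :* b := b :* a) refl _ _))

    norm-positive : 0# < ν 1#
    norm-positive = nonNegative 1# , λ 0≡ν1 → 0≢1 (sym (definite 1# (sym 0≡ν1)))

-- Lipschitz continuity and unimodality of the cost functions.

module Costs {R : RealField} (em : ExcludedMiddle 0ℓ) (𝒫 : Problem R) where
  open RealField R
  open Analysis R
  open FieldSolver R
  open OrderedField em R
  open Problem 𝒫
  open SOCO 𝒫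

  F⇒0≤ : ∀ {x} → F x → 0# ≤ x
  F⇒0≤ x∈ = ≤-trans 0≤xL (proj₁ x∈)

  0≤xH : 0# ≤ xH
  0≤xH = ≤-trans 0≤xL xL≤xH

  private
    x*y≤∣x∣*∣y∣ : ∀ {x y} → x * y ≤ ∣ x ∣ * ∣ y ∣
    x*y≤∣x∣*∣y∣ {x} {y} with ≤-total 0# y
    ... | inj₁ 0≤y = ≤-trans (*-monoˡ-≤ 0≤y x≤∣x∣) (*-monoʳ-≤ 0≤∣x∣ x≤∣x∣)
    ... | inj₂ y≤0 = ≤-trans (≤-reflexive (solve 2 (λ x y → x :* y := :- x :* :- y) refl x y))
      (≤-trans (*-monoˡ-≤ (linear y≤0 (solve 1 (λ y → :- y :- :0 := :0 :- y) refl y)) -x≤∣x∣)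
            (*-monoʳ-≤ 0≤∣x∣ -x≤∣x∣))

  module _ {c : Cost} (adm : IsAdmissible c) where
    open IsAdmissible adm

    0≤G : 0# ≤ G
    0≤G = ≤-trans 0≤∣x∣ (proj₁ (proj₂ (subgradient xL (≤-refl , xL≤xH))))

    0≤B : 0# ≤ B
    0≤B = ≤-trans (nonNegative xL (≤-refl , xL≤xH)) (bounded xL (≤-refl , xL≤xH))

    -- A subgradient at `x` limits how far the cost can drop on the way to `y`; the other direction
    -- is the same with the points exchanged.
    cost-lipschitz : ∀ {x y} → F x → F y → c x - c y ≤ G * ∣ x - y ∣
    cost-lipschitz {x} {y} x∈ y∈ with subgradient x x∈
    ... | g , ∣g∣≤G , sub = linear (sub y y∈ ⊕ x*y≤∣x∣*∣y∣ {g} {x - y}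
          ⊕ *-monoˡ-≤ (0≤∣x∣ {x - y}) ∣g∣≤G)
      (solve 8 (λ cx cy g x y G d a → G :* d :- (cx :- cy) :=
            (cy :+ (a :* d :+ G :* d)) :- ((cx :+ g :* (y :- x)) :+ (g :* (x :- y) :+ a :* d)))
        refl _ _ _ _ _ _ _ _)

    module _ {z : Carrier} (z-min : IsMinimizer F c z) where
      -- Tested at `z`, where the cost is no larger, a subgradient at a point strictly to the right
      -- of `z` turns out nonnegative.
      increasing-right : ∀ {p q} → F p → F q → z < p → p ≤ q → c p ≤ c q
      increasing-right {p} {q} p∈ q∈ z<p p≤q with subgradient p p∈
      ... | g , _ , sub = linear (sub q q∈ ⊕ *-nonNegative 0≤g (0≤y-x p≤q))
        (solve 5 (λ cp cq g p q → cq :- cp := cq :+ g :* (q :- p) :- ((cp :+ g :* (q :- p)) :+ :0))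
              refl _ _ _ _ _)
        where
        0≤g : 0# ≤ g
        0≤g = *-cancelˡ-≤ (0<y-x z<p) (linear (sub z (proj₁ z-min) ⊕ proj₂ z-min p p∈)
          (solve 5 (λ cp cz g p z → (p :- z) :* g :- (p :- z) :* :0 :=
                (cz :+ cp) :- ((cp :+ g :* (z :- p)) :+ cz)) refl _ _ _ _ _))

      decreasing-left : ∀ {p q} → F p → F q → q ≤ p → p ≤ z → c p ≤ c q
      decreasing-left {p} {q} p∈ q∈ q≤p p≤z with em {p ≡ z}
      -- At the minimizer itself a subgradient may have either sign.
      ... | yes refl = proj₂ z-min q q∈
      ... | no  p≢z with subgradient p p∈
      ...   | g , _ , sub = linear (sub q q∈ ⊕ *-monoʳ-≤ (0≤y-x q≤p) g≤0)
        (solve 5 (λ cp cq g p q → cq :- cp :=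
              cq :+ (p :- q) :* :0 :- ((cp :+ g :* (q :- p)) :+ (p :- q) :* g)) refl _ _ _ _ _)
        where
        g≤0 : g ≤ 0#
        g≤0 = *-cancelˡ-≤ (0<y-x (p≤z , p≢z)) (linear (sub z (proj₁ z-min) ⊕ proj₂ z-min p p∈)
          (solve 5 (λ cp cz g p z → (z :- p) :* :0 :- (z :- p) :* g :=
                (cz :+ cp) :- ((cp :+ g :* (z :- p)) :+ cz)) refl _ _ _ _ _))

    cost-minimizer : ∃ (IsMinimizer F c)
    cost-minimizer = lipschitz-minimizer c xL≤xH 0≤G (λ x y x∈ y∈ → cost-lipschitz x∈ y∈)

-- Existence of the work functions and their comparison with offline strategies.

module WorkFunctions {R : RealField} (em : ExcludedMiddle 0ℓ) (𝒫 : Problem R)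
  (N : RealField.Carrier R → RealField.Carrier R) (isNorm-N : Analysis.IsNorm R N)
  (c : ℕ → SOCO.Cost 𝒫) (adm : SOCO.AdmissibleSequence 𝒫 c) where
  open RealField R
  open SOCO 𝒫
  open Analysis R
  open FieldSolver R
  open OrderedField em R
  open Norms em R
  open Problem 𝒫
  open Costs em 𝒫

  n : Carrier
  n = N 1#

  0<n : 0# < n
  0<n = norm-positive isNorm-N

  0≤n : 0# ≤ n
  0≤n = <⇒≤ 0<n

  N≡ : ∀ x → N x ≡ n * ∣ x ∣
  N≡ = norm≡∣∣ isNorm-N

  N≡-F : ∀ {x} → F x → N x ≡ n * x
  N≡-F {x} x∈ = trans (N≡ x) (cong (n *_) (0≤x⇒∣x∣≡x (F⇒0≤ x∈)))

  -- Required on the whole line, where the recursion is continued by the same formula with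
  -- minimizers still taken in `F`.
  Lipschitz : (Carrier → Carrier) → Set
  Lipschitz w = ∀ x y → w x - w y ≤ n * ∣ x - y ∣

  N-lipschitz : Lipschitz N
  N-lipschitz x y = linear (IsNorm.triangle isNorm-N (x - y) y ⊕ ≤-reflexive (N≡ (x - y))
        ⊕ ≤-reflexive (cong N (solve 2 (λ x y → x := (x :- y) :+ y) refl x y)))
    (solve 5 (λ d x y e f → d :- (x :- y) := (e :+ y) :+ (d :+ f) :- (f :+ (e :+ x)))
      refl _ _ _ _ _)

  IsNext : ℕ → (Carrier → Carrier) → (Carrier → Carrier) → Set
  IsNext t w w′ = ∀ x → IsMinimum F (λ y → w y + c t y + N (x - y)) (w′ x)

  abstract
    -- The objective has a minimizer because it is Lipschitz with constant `n + G + n`, from the old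
    -- work function, the cost and the norm.
    next : ∀ {w} t → Lipschitz w → ∃ (IsNext t w)
    next {w} t lip = (λ x → f x (proj₁ (min x))) , λ x → proj₁ (min x) , proj₂ (min x) , refl
      where
      f : Carrier → Carrier → Carrier
      f x y = w y + c t y + N (x - y)
      min : ∀ x → ∃ (IsMinimizer F (f x))
      min x = lipschitz-minimizer (f x) xL≤xH
        (linear (0≤n ⊕ 0≤G (adm t) ⊕ 0≤n)
              (solve 2 (λ n G → n :+ G :+ n :- :0 := n :+ (G :+ n) :- (:0 :+ (:0 :+ :0))) refl n G))
        λ y z y∈ z∈ → linear (lip y z ⊕ cost-lipschitz (adm t) y∈ z∈ ⊕ N-lipschitz (x - y) (x - z)
            ⊕ *-monoʳ-≤ 0≤n (∣∣-lub {x - y - (x - z)} {∣ y - z ∣}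
               (linear (∣x-y∣≥y-x {y} {z})
                     (solve 4 (λ x y z d → d :- (x :- y :- (x :- z)) := d :- (z :- y))
                     refl x y z _))
               (linear (x≤∣x∣ {y - z})
                     (solve 4 (λ x y z d → d :- :- (x :- y :- (x :- z)) := d :- (y :- z))
                     refl x y z _))))
          (solve 10 (λ n G d e wy wz cy cz Ny Nz →
              (n :+ G :+ n) :* d :- ((wy :+ cy :+ Ny) :- (wz :+ cz :+ Nz)) :=
              (n :* d :+ (G :* d :+ (n :* e :+ n :* d)))
                    :- ((wy :- wz) :+ ((cy :- cz) :+ ((Ny :- Nz) :+ n :* e))))
            refl n G _ _ _ _ _ _ _ _)

  -- The minimizer for `y` is a candidate for `x`, at an extra cost of at most `N (x - y)`.
  next-lipschitz : ∀ {w w′} t → IsNext t w w′ → Lipschitz w′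
  next-lipschitz {w} {w′} t isMin x y with isMin x | isMin y
  ... | a , (a∈ , a-min) , eqa | b , (b∈ , b-min) , eqb =
    linear (≤-reflexive (sym eqa) ⊕ a-min b b∈ ⊕ ≤-reflexive eqb ⊕ N-lipschitz (x - b) (y - b)
        ⊕ ≤-reflexive (cong (λ d → n * ∣ d ∣)
              (solve 3 (λ x y b → x :- b :- (y :- b) := x :- y) refl x y b)))
      (solve 8 (λ wx wy p q Nx Ny e d →
          d :- (wx :- wy) :=
          (p :+ ((q :+ Nx) :+ (wy :+ (e :+ d)))) :- (wx :+ (p :+ ((q :+ Ny) :+ ((Nx :- Ny) :+ e)))))
        refl (w′ x) (w′ y) (w a + c t a + N (x - a)) (w b + c t b) (N (x - b)) (N (y - b)) _ _)

  workFunction : ∀ t → ∃ λ w → Lipschitz w × IsWorkFunction N (applyDownFrom c t) w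
  workFunction zero    = N , N-lipschitz , initial λ _ _ → refl
  workFunction (suc t) = let w , lip , isWork = workFunction t in
    proj₁ (next t lip) , next-lipschitz t
          (proj₂ (next t lip)) , step isWork λ x _ → proj₂ (next t lip) x

  w : ℕ → Carrier → Carrier
  w t = proj₁ (workFunction t)

  w-isWork : ∀ t → IsWorkFunction N (applyDownFrom c t) (w t)
  w-isWork t = proj₂ (proj₂ (workFunction t))

  w-minimum : ∀ t → IsNext t (w t) (w (suc t))
  w-minimum t = proj₂ (next t (proj₁ (proj₂ (workFunction t))))

  w-step : ∀ t x {y} → F y → w (suc t) x ≤ w t y + c t y + n * ∣ x - y ∣
  w-step t x {y} y∈ with w-minimum t x
  ... | _ , (_ , min) , eq = ≤-trans (≤-reflexive (sym eq))
    (≤-trans (min y y∈) (≤-reflexive (cong (w t y + c t y +_) (N≡ (x - y)))))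

  w-attained : ∀ t x → ∃ λ y → F y × w t y + c t y + n * ∣ x - y ∣ ≤ w (suc t) x
  w-attained t x with w-minimum t x
  ... | y , (y∈ , _) , eq = y , y∈ , ≤-reflexive
        (trans (cong (w t y + c t y +_) (sym (N≡ (x - y)))) eq)

  w-stay : ∀ t {x} → F x → w (suc t) x ≤ w t x + c t x
  w-stay t {x} x∈ = linear (w-step t x x∈ ⊕ *-monoʳ-≤ 0≤n (∣x-x∣≤0 {x}))
    (solve 5 (λ w w′ c n d → w :+ c :- w′ := w :+ c :+ n :* d :+ n :* :0 :- (w′ :+ n :* d))
          refl _ _ _ _ _)

  -- The trajectory, followed by a move to `v`, is a candidate in the recursion. The end point is
  -- general because the induction takes `v` to be the next position.
  w-trajectory : ∀ (x : ℕ → Carrier) T → x 0 ≡ 0# → (∀ t → t ℕ.< T → F (x (suc t))) → ∀ {v} → F v →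
    w T v ≤ ∑[ T ] (λ t → c t (x (suc t)) + n * ∣ x (suc t) - x t ∣) + n * ∣ v - x T ∣
  w-trajectory x zero    x₀≡0 x∈ {v} v∈ = ≤-reflexive (trans (N≡ v)
    (trans (cong (λ y → n * ∣ y ∣) (trans
          (solve 1 (λ v → v := v :- :0) refl v) (cong (λ y → v - y) (sym x₀≡0))))
      (solve 1 (λ y → y := :0 :+ y) refl _)))
  w-trajectory x (suc T) x₀≡0 x∈ {v} v∈ =
    linear (w-step T v (x∈ T ℕ.≤-refl) ⊕ w-trajectory x T x₀≡0
          (λ t t<T → x∈ t (ℕ.m≤n⇒m≤1+n t<T)) (x∈ T ℕ.≤-refl))
      (solve 6 (λ w′ wT c d S e → (S :+ (c :+ e) :+ d) :- w′ :=
            ((wT :+ c :+ d) :+ (S :+ e)) :- (w′ :+ wT))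
        refl _ _ _ _ _ _)

  w-static : ∀ {x} → F x → ∀ T → w T x ≤ ∑[ T ] (λ t → c t x) + n * x
  w-static x∈ zero    = ≤-reflexive (trans (N≡-F x∈) (solve 1 (λ y → y := :0 :+ y) refl _))
  w-static x∈ (suc T) = linear (w-stay T x∈ ⊕ w-static x∈ T)
    (solve 5 (λ w′ w c S e → (S :+ c :+ e) :- w′ := ((w :+ c) :+ (S :+ e)) :- (w′ :+ w))
          refl _ _ _ _ _)

-- Service and movement of the randomly biased greedy actions.

module Dynamics {R : RealField} (em : ExcludedMiddle 0ℓ) (𝒫 : Problem R)
  (N : RealField.Carrier R → RealField.Carrier R) (isNorm-N : Analysis.IsNorm R N)
  (c : ℕ → SOCO.Cost 𝒫) (adm : SOCO.AdmissibleSequence 𝒫 c) (A : SOCO.Algorithm 𝒫) (rbg : SOCO.IsRBG 𝒫 N A) where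
  open RealField R
  open SOCO 𝒫
  open Analysis R
  open FieldSolver R
  open OrderedField em R
  open Problem 𝒫
  open Costs em 𝒫
  open FiniteSums em R
  open Midpoints em R
  open WorkFunctions em 𝒫 N isNorm-N c adm public

  -- X t is the action xᵗ⁺¹ and m t below is the minimum of Yᵗ⁺¹.
  X : ℕ → Carrier → Carrier
  X t r = A r (applyDownFrom c t)

  module _ {r : Carrier} (r∈ : InSeed r) where

    X∈F : ∀ t → F (X t r)
    X∈F t = proj₁ (rbg r r∈ _ (w t) (w-isWork t))

    -- As `F` lies in the nonnegative half-line, the bias is linear there; the exchange and
    -- concavity arguments rest on this.
    X-minimal : ∀ t {b} → F b → w t (X t r) + r * (n * X t r) ≤ w t b + r * (n * b)
    X-minimal t b∈ = subst₂ (λ x y → w t (X t r) + r * x ≤ w t _ + r * y)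
      (N≡-F (X∈F t)) (N≡-F b∈) (proj₂ (rbg r r∈ _ (w t) (w-isWork t)) _ b∈)

    0≤X : ∀ t → 0# ≤ X t r
    0≤X t = F⇒0≤ (X∈F t)

    X≤xH : ∀ t → X t r ≤ xH
    X≤xH t = proj₂ (X∈F t)

  m : ℕ → Carrier → Carrier
  m t r = w t (X t r) + r * (n * X t r)

  private
    -- The hypothesis rearranges to `(s - r) * (n * y) ≤ (s - r) * (n * x)`. It arises by adding the
    -- optimality of two actions tested against each other.
    X-exchange : ∀ {r s x y} → r < s → r * (n * x) + s * (n * y) ≤ r * (n * y) + s * (n * x) → y ≤ x
    X-exchange {r} {s} {x} {y} r<s p = *-cancelˡ-≤ 0<n (*-cancelˡ-≤ (0<y-x r<s) (linear p
      (solve 5 (λ r s n x y → (s :- r) :* (n :* x) :- (s :- r) :* (n :* y) :=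
          (r :* (n :* y) :+ s :* (n :* x)) :- (r :* (n :* x) :+ s :* (n :* y)))
        refl r s n x y)))

  X-antitone : ∀ t {r s} → InSeed r → InSeed s → r ≤ s → X t s ≤ X t r
  X-antitone t {r} {s} r∈ s∈ r≤s with em {r ≡ s}
  ... | yes refl = ≤-refl
  ... | no  r≢s  = X-exchange (r≤s , r≢s)
        (linear (X-minimal r∈ t (X∈F s∈ t) ⊕ X-minimal s∈ t (X∈F r∈ t))
    (solve 6 (λ wr ws a b c d → c :+ d :- (a :+ b) :=
          (ws :+ c) :+ (wr :+ d) :- ((wr :+ a) :+ (ws :+ b)))
      refl (w t (X t r)) (w t (X t s)) _ _ _ _))

  -- The action at `r` is a candidate at `s`, so `n * X t r` is a supergradient of `m t` at `r`.
  m-concave : ∀ t {r s} → InSeed r → InSeed s → m t s - m t r ≤ (s - r) * (n * X t r)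
  m-concave t {r} {s} r∈ s∈ = linear (X-minimal s∈ t (X∈F r∈ t))
    (solve 5 (λ r s w x a → (s :- r) :* x :- (a :- (w :+ r :* x)) := (w :+ s :* x) :- a)
      refl r s (w t (X t r)) (n * X t r) (m t s))

  -- The bias r N is strictly flatter than N, so the minimum defining the work
  -- function is attained by staying put.
  w-tight : ∀ t {r} → InSeed r → w t (X (suc t) r) + c t (X (suc t) r) ≤ w (suc t) (X (suc t) r)
  w-tight t {r} r∈ with w-attained t (X (suc t) r)
  ... | y , y∈ , attained = subst (λ z → w t z + c t z ≤ w (suc t) x) y≡x
      (linear (attained ⊕ *-nonNegative 0≤n (0≤∣x∣ {x - y}))
        (solve 3 (λ a d b → b :- a := (b :+ d) :- ((a :+ d) :+ :0)) refl (w t y + c t y) _ _))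
    where
    x = X (suc t) r
    -- Moving from `y` to `x` must be worth `n * ∣ x - y ∣` against staying at `y`, but the choice
    -- of `x` gains only the difference in bias. As -1 < r < 1, the two points coincide.
    ∣x-y∣≤ : ∣ x - y ∣ ≤ r * (y - x)
    ∣x-y∣≤ = *-cancelˡ-≤ 0<n (linear (attained ⊕ X-minimal r∈ (suc t) y∈ ⊕ w-stay t y∈)
      (solve 8 (λ r n x y d a b b′ → n :* (r :* (y :- x)) :- n :* d :=
          (b :+ (b′ :+ r :* (n :* y) :+ a)) :- ((a :+ n :* d) :+ ((b :+ r :* (n :* x)) :+ b′)))
        refl r n x y ∣ x - y ∣ (w t y + c t y) (w (suc t) x) (w (suc t) y)))
    y≡x : y ≡ x
    y≡x = ≤-antisym
      (*-cancelˡ-≤ (0<y-x (proj₂ r∈)) (linear (≤-trans ∣x-y∣≥y-x ∣x-y∣≤)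
        (solve 3 (λ r x y → (:1 :- r) :* x :- (:1 :- r) :* y := r :* (y :- x) :- (y :- x))
              refl r x y)))
      (*-cancelˡ-≤ (0<y-x (proj₁ r∈)) (linear (≤-trans x≤∣x∣ ∣x-y∣≤)
        (solve 3 (λ r x y → (r :- :- :1) :* y :- (r :- :- :1) :* x := r :* (y :- x) :- (x :- y))
              refl r x y)))

  -- By `w-tight`, `m (suc t) r` splits off the cost at `X (suc t) r`; the remainder is a candidate
  -- value for the minimum `m t r`.
  service≤Δm : ∀ t {r} → InSeed r → c t (X (suc t) r) ≤ m (suc t) r - m t r
  service≤Δm t {r} r∈ = linear (w-tight t r∈ ⊕ X-minimal r∈ t (X∈F r∈ (suc t)))
    (solve 5 (λ w w′ c x a → (w′ :+ x :- a) :- c := (w′ :+ (w :+ x)) :- ((w :+ c) :+ a))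
      refl (w t (X (suc t) r)) _ _ (r * (n * X (suc t) r)) (m t r))

  0≤m₀ : ∀ {r} → InSeed r → 0# ≤ m 0 r
  0≤m₀ {r} r∈ = linear
        (*-nonNegative (0≤y-x (<⇒≤ (proj₁ r∈))) (*-nonNegative 0≤n (0≤X r∈ 0))
        ⊕ ≤-reflexive (sym (N≡-F (X∈F r∈ 0))))
    (solve 3 (λ r nx Nx → (Nx :+ r :* nx) :- :0 := ((r :- :- :1) :* nx :+ Nx) :- (:0 :+ nx))
      refl r (n * X 0 r) (N (X 0 r)))

  m≤ : ∀ t {r v} → InSeed r → F v → m t r ≤ w t v + r * (n * v)
  m≤ t r∈ v∈ = X-minimal r∈ t v∈

  -- Tightness removes the new work function: consecutive actions minimize objectives that differ
  -- only by the cost `c t`.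
  X-minimal′ : ∀ t {r b} → InSeed r → F b →
    w t (X (suc t) r) + c t (X (suc t) r) + r * (n * X (suc t) r) ≤ w t b + c t b + r * (n * b)
  X-minimal′ t {r} {b} r∈ b∈ = linear (w-tight t r∈ ⊕ X-minimal r∈ (suc t) b∈ ⊕ w-stay t b∈)
    (solve 6 (λ a a′ b b′ x y → (b :+ y) :- (a :+ x) :=
          (a′ :+ (b′ :+ y :+ b)) :- (a :+ (a′ :+ x :+ b′)))
      refl (w t (X (suc t) r) + c t (X (suc t) r)) _ (w t b + c t b) (w (suc t) b) _ _)

  module _ (t : ℕ) {z : Carrier} (z-min : IsMinimizer F (c t) z) where

    private
      -- Testing each action against the other cancels the work functions; the cost difference left
      -- over has the right sign by hypothesis.
      exchange : ∀ {r r′} → InSeed r → InSeed r′ → c t (X t r) ≤ c t (X (suc t) r′) →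
        r * (n * X t r) + r′ * (n * X (suc t) r′) ≤ r * (n * X (suc t) r′) + r′ * (n * X t r)
      exchange {r} {r′} r∈ r′∈ cp≤cq =
        linear (X-minimal r∈ t (X∈F r′∈ (suc t)) ⊕ X-minimal′ t r′∈ (X∈F r∈ t) ⊕ cp≤cq)
          (solve 8 (λ wp wq cp cq a b d e → (d :+ e) :- (a :+ b) :=
              ((wq :+ d) :+ (wp :+ cp :+ e :+ cq)) :- ((wp :+ a) :+ (wq :+ cq :+ b :+ cp)))
            refl (w t (X t r)) (w t (X (suc t) r′)) _ _ _ _ _ _)

    -- If the action moved down, away from `z`, the cost would not decrease and the exchange would
    -- force it up again. At equal seeds the exchange inequality is vacuous, hence the strict one.
    moves-up : ∀ {r r′} → InSeed r → InSeed r′ → r′ < r → X t r ≤ z → X t r ≤ X (suc t) r′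
    moves-up {r} {r′} r∈ r′∈ r′<r p≤z with ≤-total (X t r) (X (suc t) r′)
    ... | inj₁ p≤q = p≤q
    ... | inj₂ q≤p = X-exchange r′<r (linear
      (exchange r∈ r′∈ (decreasing-left (adm t) z-min (X∈F r∈ t) (X∈F r′∈ (suc t)) q≤p p≤z))
      (solve 4 (λ a b d e → (e :+ d) :- (b :+ a) := (d :+ e) :- (a :+ b)) refl _ _ _ _))

    moves-down : ∀ {r r′} → InSeed r → InSeed r′ → r < r′ → z < X t r → X (suc t) r′ ≤ X t r
    moves-down {r} {r′} r∈ r′∈ r<r′ z<p with ≤-total (X (suc t) r′) (X t r)
    ... | inj₁ q≤p = q≤p
    ... | inj₂ p≤q = X-exchange r<r′
      (exchange r∈ r′∈ (increasing-right (adm t) z-min (X∈F r∈ t) (X∈F r′∈ (suc t)) z<p p≤q))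

  service movement : ℕ → Carrier → Carrier
  service  T r = ∑[ T ] (λ t → c t (X (suc t) r))
  movement T r = ∑[ T ] (λ t → ∣ X (suc t) r - X t r ∣)

  service≤m : ∀ T {r} → InSeed r → service T r ≤ m T r - m 0 r
  service≤m T r∈ = ≤-trans (∑-mono T (λ t _ → service≤Δm t r∈))
        (≤-reflexive (∑-telescope T (λ t → m t _)))

  average-service : ∀ T k {v} → F v → average k (service T) ≤ w T v
  average-service T k {v} v∈ = ≤-trans
    (average-mono k {g = λ r → w T v + n * v * r} λ {r} r∈ → linear (service≤m T r∈ ⊕ 0≤m₀ r∈
          ⊕ m≤ T r∈ v∈)
      (solve 7 (λ S m₀ m w n v r → (w :+ n :* v :* r) :- S :=
          ((m :- m₀) :+ (m₀ :+ (w :+ r :* (n :* v)))) :- (S :+ (:0 :+ m)))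
        refl (service T r) (m 0 r) (m T r) (w T v) n v r))
    (≤-reflexive (trans (average-+ k (λ _ → w T v) (λ r → n * v * r))
      (trans (cong₂ _+_ (average-const k (w T v))
            (trans (average-* k (n * v) (λ r → r)) (cong (n * v *_) (average-id k))))
        (solve 2 (λ w a → w :+ a :* :0 := w) refl _ _))))

  module _ (k : ℕ) where
    private
      σ : ℕ → Carrier
      σ = midpoint k
      σ∈ : ∀ {i} → i ℕ.≤ k → InSeed (σ i)
      σ∈ = midpoint∈seeds
      h : Carrier
      h = 2# * width k
      -- The change of `D` between neighbouring seeds per unit of distance: the grid spacing times
      -- the slope factor `n`.
      c′ : Carrier
      c′ = h * n
      σ-decreasing : ∀ i → σ (suc i) < σ i
      σ-decreasing i = ≰⇒> λ p → <⇒≱ (*-positive 0<2 (0<width k))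
            (linear (p ⊕ ≤-reflexive (sym (midpoint-step k i)))
        (solve 3 (λ a b h → :0 :- h := b :+ (a :- b) :- (a :+ h)) refl (σ i) (σ (suc i)) h))
      Δm : ℕ → ℕ → Carrier
      Δm t i = m (suc t) (σ i) - m t (σ i)

    step-movement : ∀ t →
      ∑[ suc k ] (λ i → c′ * ∣ X (suc t) (σ i) - X t (σ i) ∣)
            ≤ Δm t 0 + Δm t k + (2# + 2# + 1#) * c′ * xH
    step-movement t = grid-movement k {p = λ i → X t (σ i)} {q = λ i → X (suc t) (σ i)} {D = Δm t} {c = c′} {z = proj₁ z} {W = xH}
      (*-nonNegative (*-nonNegative 0≤2 (0≤width k)) 0≤n)
      (λ i i<k → X-antitone t (σ∈ i<k) (σ∈ (ℕ.<⇒≤ i<k)) (<⇒≤ (σ-decreasing i)))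
      (λ i i<k → X-antitone (suc t) (σ∈ i<k) (σ∈ (ℕ.<⇒≤ i<k)) (<⇒≤ (σ-decreasing i)))
      (λ i i≤k → 0≤X (σ∈ i≤k) t , X≤xH (σ∈ i≤k) t)
      (λ i i≤k → 0≤X (σ∈ i≤k) (suc t) , X≤xH (σ∈ i≤k) (suc t))
      (λ i i≤k → ≤-trans (IsAdmissible.nonNegative (adm t) _ (X∈F (σ∈ i≤k) (suc t))) (service≤Δm t (σ∈ i≤k)))
      (λ i i<k → moves-up t (proj₂ z) (σ∈ (ℕ.<⇒≤ i<k)) (σ∈ i<k) (σ-decreasing i))
      (λ i i<k → moves-down t (proj₂ z) (σ∈ i<k) (σ∈ (ℕ.<⇒≤ i<k)) (σ-decreasing i))
      (λ i i<k → linear (slope↘ t (σ∈ (ℕ.<⇒≤ i<k)) (σ∈ i<k)) (cong (λ d → Δm t i - Δm t (suc i) - d)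
          (trans (solve 4
                (λ h n q p → h :* n :* (q :- p) := h :* (n :* q) :- h :* (n :* p)) refl h n _ _)
            (cong (λ h → h * (n * X (suc t) (σ i)) - h * (n * X t (σ (suc i)))) (sym (midpoint-step k i))))))
      (λ i i<k → linear (slope↗ t (σ∈ (ℕ.<⇒≤ i<k)) (σ∈ i<k)) (cong (λ d → Δm t (suc i) - Δm t i - d)
          (trans (solve 4
                (λ h n q p → h :* n :* (q :- p) := h :* (n :* q) :- h :* (n :* p)) refl h n _ _)
            (cong (λ h → h * (n * X t (σ i)) - h * (n * X (suc t) (σ (suc i)))) (sym (midpoint-step k i))))))
      where
      z : ∃ (IsMinimizer F (c t))
      z = cost-minimizer (adm t)
      -- The supergradient of `m (suc t)` is taken at `r` and that of `m t` at `s`, so the new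
      -- action at one seed meets the old action at the other; this is the index shift of
      -- `grid-movement`.
      slope↘ : ∀ t {r s} → InSeed r → InSeed s →
        (r - s) * (n * X (suc t) r) - (r - s) * (n * X t s)
              ≤ (m (suc t) r - m t r) - (m (suc t) s - m t s)
      slope↘ t {r} {s} r∈ s∈ = linear (m-concave (suc t) r∈ s∈ ⊕ m-concave t s∈ r∈)
        (solve 8 (λ r s x y a b c d → ((a :- b) :- (c :- d)) :- ((r :- s) :* x :- (r :- s) :* y) :=
            ((s :- r) :* x :+ (r :- s) :* y) :- ((c :- a) :+ (b :- d)))
          refl r s (n * X (suc t) r) (n * X t s) (m (suc t) r) (m t r) (m (suc t) s) (m t s))
      slope↗ : ∀ t {r s} → InSeed r → InSeed s →
        (r - s) * (n * X t r) - (r - s) * (n * X (suc t) s)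
              ≤ (m (suc t) s - m t s) - (m (suc t) r - m t r)
      slope↗ t {r} {s} r∈ s∈ = linear (m-concave t r∈ s∈ ⊕ m-concave (suc t) s∈ r∈)
        (solve 8 (λ r s x y a b c d → ((c :- d) :- (a :- b)) :- ((r :- s) :* x :- (r :- s) :* y) :=
            ((s :- r) :* x :+ (r :- s) :* y) :- ((d :- b) :+ (a :- c)))
          refl r s (n * X t r) (n * X (suc t) s) (m (suc t) r) (m t r) (m (suc t) s) (m t s))

    -- The changes of `m` at the two outermost midpoints telescope over `t`. These seeds are
    -- opposite, so the biases in `w T v + r * (n * v)` cancel, leaving twice `w T v` and `T` errors
    -- of the order of the mesh.
    average-movement : ∀ T {v} → F v →
      n * average k (movement T) ≤ w T v + fromℕ T * ((2# + 2# + 1#) * n * xH) * width k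
    average-movement T {v} v∈ = *-cancelˡ-≤ 0<2
          (≤-trans (≤-reflexive unfold) (≤-trans (∑-mono T (λ t _ → step-movement t))
      (≤-trans (≤-reflexive telescope) bound)))
      where
      unfold : 2# * (n * average k (movement T)) ≡
        ∑[ T ] (λ t → ∑[ suc k ] (λ i → c′ * ∣ X (suc t) (σ i) - X t (σ i) ∣))
      unfold = trans
            (solve 4 (λ t n w s → t :* (n :* (w :* s)) := t :* w :* n :* s) refl 2# n (width k) _)
        (trans (cong (c′ *_) (∑-swap (suc k) T (λ i t → ∣ X (suc t) (σ i) - X t (σ i) ∣)))
        (trans (sym (∑-*ˡ T c′ _)) (∑-cong T λ t → sym (∑-*ˡ (suc k) c′ _))))
      E : Carrier
      E = fromℕ T * ((2# + 2# + 1#) * n * xH) * width k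
      telescope : ∑[ T ] (λ t → Δm t 0 + Δm t k + (2# + 2# + 1#) * c′ * xH) ≡
        (m T (σ 0) - m 0 (σ 0)) + (m T (σ k) - m 0 (σ k)) + 2# * E
      telescope = trans (∑-+ T _ _) (cong₂ _+_
        (trans (∑-+ T _ _)
              (cong₂ _+_ (∑-telescope T (λ t → m t (σ 0))) (∑-telescope T (λ t → m t (σ k)))))
        (trans (∑-const T _)
              (solve 6 (λ T f t ω n W → T :* (f :* (t :* ω :* n) :* W) :=
              t :* (T :* (f :* n :* W) :* ω))
          refl (fromℕ T) (2# + 2# + 1#) 2# (width k) n xH)))
      bound : (m T (σ 0) - m 0 (σ 0)) + (m T (σ k) - m 0 (σ k)) + 2# * E ≤ 2# * (w T v + E)
      bound = linear (m≤ T (σ∈ ℕ.z≤n) v∈ ⊕ m≤ T (σ∈ ℕ.≤-refl) v∈ ⊕ 0≤m₀ (σ∈ ℕ.z≤n)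
            ⊕ 0≤m₀ (σ∈ ℕ.≤-refl)
          ⊕ ≤-reflexive (cong (_* (n * v)) (midpoint-symmetric k)))
        (solve 9 (λ a b a₀ b₀ wv nv r s E →
            (:1 :+ :1) :* (wv :+ E) :- ((a :- a₀) :+ (b :- b₀) :+ (:1 :+ :1) :* E) :=
            ((wv :+ r :* nv) :+ ((wv :+ s :* nv) :+ (a₀ :+ (b₀ :+ :0 :* nv)))) :-
            (a :+ (b :+ (:0 :+ (:0 :+ (r :+ s) :* nv)))))
          refl (m T (σ 0)) (m T (σ k)) (m 0 (σ 0)) (m 0 (σ k)) (w T v) (n * v) (σ 0) (σ k) E)

-- The expected cost: existence and upper bound.

module ExpectedCost {R : RealField} (em : ExcludedMiddle 0ℓ) (𝒫 : Problem R)
  (N : RealField.Carrier R → RealField.Carrier R) (isNorm-N : Analysis.IsNorm R N)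
  (c : ℕ → SOCO.Cost 𝒫) (adm : SOCO.AdmissibleSequence 𝒫 c) (A : SOCO.Algorithm 𝒫) (rbg : SOCO.IsRBG 𝒫 N A) where
  open RealField R
  open SOCO 𝒫
  open Analysis R
  open FieldSolver R
  open OrderedField em R
  open Integration em R
  open FiniteSums em R
  open Midpoints em R
  open Norms em R
  open Problem 𝒫
  open Costs em 𝒫
  open Dynamics em 𝒫 N isNorm-N c adm A rbg public

  ν : Carrier
  ν = ∥ 1# ∥

  0<ν : 0# < ν
  0<ν = norm-positive isNorm

  0≤ν : 0# ≤ ν
  0≤ν = <⇒≤ 0<ν

  ∥∥≡ : ∀ x → ∥ x ∥ ≡ ν * ∣ x ∣
  ∥∥≡ = norm≡∣∣ isNorm

  0≤ν*∣x∣ : ∀ x → 0# ≤ ν * ∣ x ∣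
  0≤ν*∣x∣ _ = *-nonNegative 0≤ν 0≤∣x∣

  -- What the chosen actions share with the constant initial action 0, which may lie outside `F`.
  record IsActionFunction (a : Carrier → Carrier) : Set where
    field
      nonNegative : ∀ {r} → InSeed r → 0# ≤ a r
      bounded     : ∀ {r} → InSeed r → a r ≤ xH
      antitone    : ∀ {r s} → InSeed r → InSeed s → r ≤ s → a s ≤ a r

  actions-isActionFunction : ∀ i t → IsActionFunction (λ r → actions A c i r t)
  actions-isActionFunction i zero = record
    { nonNegative = λ _ → ≤-refl
    ; bounded     = λ _ → 0≤xH
    ; antitone    = λ _ _ _ → ≤-refl
    }
  actions-isActionFunction i (suc t) = record
    { nonNegative = λ r∈ → 0≤X r∈ (i ℕ.+ t)
    ; bounded     = λ r∈ → X≤xH r∈ (i ℕ.+ t)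
    ; antitone    = X-antitone (i ℕ.+ t)
    }

  boundedVariation-0 : BoundedVariation (λ _ → 0#)
  boundedVariation-0 = record
    { g = λ _ → 0#
    ; bound = 0#
    ; g-nonNegative = λ _ → ≤-refl
    ; g-bounded = λ _ → ≤-refl
    ; variation = λ _ _ _ → ≤-trans ∣x-x∣≤0 (≤-reflexive (solve 0 (:0 := :0 :- :0) refl))
    }

  boundedVariation-+ : ∀ {f f′} → BoundedVariation f → BoundedVariation f′ →
    BoundedVariation (λ r → f r + f′ r)
  boundedVariation-+ V V′ = record
    { g = λ r → V.g r + V′.g r
    ; bound = V.bound + V′.bound
    ; g-nonNegative = λ r∈ → linear (V.g-nonNegative r∈ ⊕ V′.g-nonNegative r∈)
        (solve 2 (λ x y → (x :+ y) :- :0 := (x :+ y) :- (:0 :+ :0)) refl _ _)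
    ; g-bounded = λ r∈ → V.g-bounded r∈ ⊕ V′.g-bounded r∈
    ; variation = λ r∈ s∈ r≤s →
        let v = V.variation r∈ s∈ r≤s ; v′ = V′.variation r∈ s∈ r≤s in ∣x-y∣-lub
          (linear (≤-trans x≤∣x∣ v ⊕ ≤-trans x≤∣x∣ v′)
            (solve 8 (λ f f′ h h′ a a′ b b′ → ((a :+ a′) :- (b :+ b′))
                  :- ((f :+ f′) :- (h :+ h′)) :=
                ((a :- b) :+ (a′ :- b′)) :- ((f :- h) :+ (f′ :- h′))) refl _ _ _ _ _ _ _ _))
          (linear (≤-trans ∣x-y∣≥y-x v ⊕ ≤-trans ∣x-y∣≥y-x v′)
            (solve 8 (λ f f′ h h′ a a′ b b′ → ((a :+ a′) :- (b :+ b′))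
                  :- ((h :+ h′) :- (f :+ f′)) :=
                ((a :- b) :+ (a′ :- b′)) :- ((h :- f) :+ (h′ :- f′))) refl _ _ _ _ _ _ _ _))
    }
    where
    module V = BoundedVariation V
    module V′ = BoundedVariation V′

  module _ (t : ℕ) {a b : Carrier → Carrier} (isA : IsActionFunction a) (isB : IsActionFunction b)
    (a∈F : ∀ {r} → InSeed r → F (a r)) where
    private
      module A′ = IsActionFunction isA
      module B′ = IsActionFunction isB
      cost : Carrier → Carrier
      cost r = c t (a r) + 1# * ∥ a r - b r ∥

      cost-difference : ∀ {r s d e} → InSeed r → InSeed s → ∣ a r - a s ∣ ≤ d → ∣ b r - b s ∣ ≤ e →
        cost r - cost s ≤ G * d + ν * (d + e)
      cost-difference {r} {s} {d} {e} r∈ s∈ da de = linear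
        (cost-lipschitz (adm t) (a∈F r∈) (a∈F s∈) ⊕ *-monoʳ-≤ (0≤G (adm t)) da
          ⊕ *-monoʳ-≤ 0≤ν distance ⊕ ≤-reflexive (∥∥≡ (a r - b r))
                ⊕ ≤-reflexive (sym (∥∥≡ (a s - b s))))
        (solve 11 (λ cr cs nr ns G ν D d e x y → (G :* d :+ ν :* (d :+ e))
              :- ((cr :+ :1 :* nr) :- (cs :+ :1 :* ns)) :=
            (G :* D :+ (G :* d :+ (ν :* (y :+ (d :+ e)) :+ (ν :* x :+ ns)))) :-
            ((cr :- cs) :+ (G :* D :+ (ν :* x :+ (nr :+ ν :* y)))))
          refl (c t (a r)) (c t (a s)) (∥ a r - b r ∥) (∥ a s - b s ∥) G ν (∣ a r - a s ∣) d e
            ∣ a r - b r ∣ ∣ a s - b s ∣)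
        where
        distance : ∣ a r - b r ∣ ≤ ∣ a s - b s ∣ + (d + e)
        distance = ∣x-y∣-lub
          (linear (x≤∣x∣ {a s - b s} ⊕ ≤-trans x≤∣x∣ da ⊕ ≤-trans ∣x-y∣≥y-x de)
            (solve 7 (λ ar as br bs y d e → y :+ (d :+ e) :- (ar :- br) :=
                y :+ (d :+ e) :- ((as :- bs) :+ ((ar :- as) :+ (bs :- br))))
                      refl (a r) (a s) (b r) (b s) _ d e))
          (linear (∣x-y∣≥y-x {a s} {b s} ⊕ ≤-trans ∣x-y∣≥y-x da ⊕ ≤-trans x≤∣x∣ de)
            (solve 7 (λ ar as br bs y d e → y :+ (d :+ e) :- (br :- ar) :=
                y :+ (d :+ e) :- ((bs :- as) :+ ((as :- ar) :+ (br :- bs))))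
                      refl (a r) (a s) (b r) (b s) _ d e))

      drop : ∀ {x y} → y ≤ x → ∣ x - y ∣ ≤ x - y
      drop y≤x = ≤-reflexive (0≤x⇒∣x∣≡x (0≤y-x y≤x))

    -- Cost and norm are Lipschitz with constants `G` and `ν`, and the variation of the antitone
    -- functions `a` and `b` is their drop.
    boundedVariation-cost : BoundedVariation cost
    boundedVariation-cost = record
      { g = λ r → G * a r + ν * (a r + b r)
      ; bound = G * xH + ν * (xH + xH)
      ; g-nonNegative = λ r∈ → linear
          (*-nonNegative (0≤G (adm t)) (A′.nonNegative r∈) ⊕ *-nonNegative 0≤ν (A′.nonNegative r∈)
                ⊕ *-nonNegative 0≤ν (B′.nonNegative r∈))
          (solve 4 (λ G ν a b → (G :* a :+ ν :* (a :+ b)) :- :0 :=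
                (G :* a :+ (ν :* a :+ ν :* b)) :- (:0 :+ (:0 :+ :0))) refl G ν _ _)
      ; g-bounded = λ r∈ → *-monoʳ-≤ (0≤G (adm t)) (A′.bounded r∈)
            ⊕ *-monoʳ-≤ 0≤ν (A′.bounded r∈ ⊕ B′.bounded r∈)
      ; variation = λ {r} {s} r∈ s∈ r≤s →
          let da = drop (A′.antitone r∈ s∈ r≤s)
              de = drop (B′.antitone r∈ s∈ r≤s)
              eq = solve 6 (λ G ν ar as br bs → G :* (ar :- as) :+ ν :* ((ar :- as) :+ (br :- bs)) :=
                     (G :* ar :+ ν :* (ar :+ br)) :- (G :* as :+ ν :* (as :+ bs)))
                           refl G ν (a r) (a s) (b r) (b s)
          in ∣x-y∣-lub
               (≤-trans (cost-difference r∈ s∈ da de) (≤-reflexive eq))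
               (≤-trans (cost-difference s∈ r∈ (≤-trans ∣x-y∣-swap da) (≤-trans ∣x-y∣-swap de))
                     (≤-reflexive eq))
      }

  boundedVariation-totalCost : ∀ i T → BoundedVariation (λ r → totalCost 1# c T (actions A c i r))
  boundedVariation-totalCost i zero    = boundedVariation-0
  boundedVariation-totalCost i (suc T) = boundedVariation-+ (boundedVariation-totalCost i T)
    (boundedVariation-cost T (actions-isActionFunction i (suc T)) (actions-isActionFunction i T)
          (λ r∈ → X∈F r∈ (i ℕ.+ T)))

  expectedCost-exists : ∀ i T → ∃ (IsExpectedCost i 1# A c T)
  expectedCost-exists i T = boundedVariation⇒expectation (boundedVariation-totalCost i T)

  private
    ∥X₀-0∥≤ : ∀ {r} → InSeed r → ν * ∣ X 0 r - 0# ∣ ≤ ν * xH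
    ∥X₀-0∥≤ r∈ = *-monoʳ-≤ 0≤ν (∣x-y∣-lub
      (linear (X≤xH r∈ 0) (solve 2 (λ x h → h :- (x :- :0) := h :- x) refl _ _))
      (linear (0≤X r∈ 0 ⊕ 0≤xH)
            (solve 2 (λ x h → h :- (:0 :- x) := (x :+ h) :- (:0 :+ :0)) refl _ _)))

    -- Here and below, the second summand on the left pays for the next move.
    lookahead-invariant : ∀ T {r} → InSeed r →
      totalCost 1# c T (actions A c 1 r) + ν * ∣ X T r - actions A c 1 r T ∣
            ≤ service T r + ν * movement T r + ν * xH
    lookahead-invariant zero {r} r∈ = linear (∥X₀-0∥≤ r∈)
      (solve 3 (λ ν x h → (:0 :+ ν :* :0 :+ ν :* h) :- (:0 :+ ν :* x) := ν :* h :- ν :* x)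
            refl ν _ xH)
    -- With lookahead 1 the position after the step is `X (suc T) r` itself, so the second summand
    -- vanishes. It differs from zero only at the start, where the position is 0 and not `X 0 r`.
    lookahead-invariant (suc T) {r} r∈ = linear
      (lookahead-invariant T r∈ ⊕ *-monoʳ-≤ 0≤ν (∣∣-triangle {X (suc T) r} {x T} (X T r))
            ⊕ ≤-reflexive (∥∥≡ (X (suc T) r - x T)) ⊕ *-monoʳ-≤ 0≤ν (∣x-x∣≤0 {X (suc T) r}))
      (solve 11 (λ C c′ b d S M p q o ν h →
          ((S :+ c′) :+ ν :* (M :+ d) :+ ν :* h) :- ((C :+ (c′ :+ :1 :* b)) :+ ν :* o) :=
          ((S :+ ν :* M :+ ν :* h) :+ (ν :* (d :+ p) :+ (ν :* q :+ ν :* :0))) :-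
          ((C :+ ν :* p) :+ (ν :* q :+ (b :+ ν :* o))))
        refl (totalCost 1# c T x) (c T (X (suc T) r)) ∥ X (suc T) r - x T ∥ (∣ X (suc T) r - X T r ∣)
          (service T r) (movement T r) (∣ X T r - x T ∣) (∣ X (suc T) r - x T ∣) (∣ X (suc T) r - X (suc T) r ∣) ν xH)
      where
      x : ℕ → Carrier
      x = actions A c 1 r

    simultaneous-invariant : ∀ T {r} → InSeed r →
      totalCost 1# c T (actions A c 0 r) + ν * ∣ X T r - actions A c 0 r T ∣
            ≤ service T r + (ν + G) * movement T r + ν * xH
    simultaneous-invariant zero {r} r∈ = linear (∥X₀-0∥≤ r∈)
      (solve 4 (λ ν G x h → (:0 :+ (ν :+ G) :* :0 :+ ν :* h) :- (:0 :+ ν :* x) := ν :* h :- ν :* x)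
            refl ν G _ xH)
    simultaneous-invariant (suc T) {r} r∈ = linear
      (simultaneous-invariant T r∈ ⊕ ≤-reflexive (∥∥≡ (X T r - x T))
            -- Without lookahead the cost is paid at `X T r` instead of `X (suc T) r`, which adds
            -- `G` to the coefficient of the movement.
            ⊕ cost-lipschitz (adm T) (X∈F r∈ T) (X∈F r∈ (suc T))
        ⊕ *-monoʳ-≤ (0≤G (adm T)) (∣x-y∣-swap {X T r} {X (suc T) r}))
      (solve 12 (λ C a b c′ d S M p e ν G h →
          ((S :+ c′) :+ (ν :+ G) :* (M :+ d) :+ ν :* h) :- ((C :+ (a :+ :1 :* b)) :+ ν :* d) :=
          ((S :+ (ν :+ G) :* M :+ ν :* h) :+ (ν :* p :+ (G :* e :+ G :* d))) :-
          ((C :+ ν :* p) :+ (b :+ ((a :- c′) :+ G :* e))))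
        refl (totalCost 1# c T x) (c T (X T r)) ∥ X T r - x T ∥ (c T (X (suc T) r)) (∣ X (suc T) r - X T r ∣)
          (service T r) (movement T r) (∣ X T r - x T ∣) (∣ X T r - X (suc T) r ∣) ν G xH)
      where
      x : ℕ → Carrier
      x = actions A c 0 r

  totalCost₁≤ : ∀ T {r} → InSeed r → totalCost 1# c T (actions A c 1 r)
        ≤ service T r + ν * movement T r + ν * xH
  totalCost₁≤ T {r} r∈ = linear (lookahead-invariant T r∈ ⊕ 0≤ν*∣x∣ (X T r - actions A c 1 r T))
    (solve 3 (λ a b d → b :- a := (b :+ d) :- ((a :+ d) :+ :0)) refl _ _ _)

  totalCost₀≤ : ∀ T {r} → InSeed r → totalCost 1# c T (actions A c 0 r)
        ≤ service T r + (ν + G) * movement T r + ν * xH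
  totalCost₀≤ T {r} r∈ = linear (simultaneous-invariant T r∈ ⊕ 0≤ν*∣x∣ (X T r - actions A c 0 r T))
    (solve 3 (λ a b d → b :- a := (b :+ d) :- ((a :+ d) :+ :0)) refl _ _ _)

  -- Serves both settings, with `β` equal to `ν` or `ν + G`. The factor `n` matches
  -- `average-movement`, which bounds `n` times the movement.
  expectation-bound : ∀ {f e β κ} T {v} → IsExpectation f e → 0# ≤ β →
    (∀ {r} → InSeed r → f r ≤ service T r + β * movement T r + κ) → F v →
    n * e ≤ (n + β) * w T v + n * κ
  expectation-bound {f} {e} {β} {κ} T {v} E 0≤β f≤ v∈ = expectation-≤ E 0≤n
    (*-nonNegative 0≤β
          (*-nonNegative (fromℕ-nonNegative T) (*-nonNegative (*-nonNegative 0≤5 0≤n) 0≤xH)))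
    λ k → linear
      (*-monoʳ-≤ 0≤n (≤-trans (average-mono k f≤) (≤-reflexive (split k)))
            ⊕ *-monoʳ-≤ 0≤n (average-service T k v∈)
        ⊕ *-monoʳ-≤ 0≤β (average-movement k T v∈))
      (solve 9 (λ n β κ f S M w E ω →
          ((n :+ β) :* w :+ n :* κ :+ β :* E :* ω) :- n :* f :=
          (n :* (S :+ β :* M :+ κ) :+ (n :* w :+ β :* (w :+ E :* ω)))
                :- (n :* f :+ (n :* S :+ β :* (n :* M))))
        refl n β κ (average k f) (average k (service T)) (average k (movement T)) (w T v) _ (width k))
    where
    0≤5 : 0# ≤ 2# + 2# + 1#
    0≤5 = linear (0≤2 ⊕ 0≤2 ⊕ 0≤1)
          (solve 2 (λ t u → (t :+ t :+ u) :- :0 := (t :+ (t :+ u)) :- (:0 :+ (:0 :+ :0)))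
          refl 2# 1#)
    split : ∀ k → average k (λ r → service T r + β * movement T r + κ) ≡
      average k (service T) + β * average k (movement T) + κ
    split k = trans (average-+ k (λ r → service T r + β * movement T r) (λ _ → κ)) (cong₂ _+_
      (trans (average-+ k (service T) (λ r → β * movement T r))
            (cong (average k (service T) +_) (average-* k β (movement T))))
      (average-const k κ))

-- Competitive ratio and regret.

module Bounds {R : RealField} (em : ExcludedMiddle 0ℓ) (𝒫 : Problem R) where
  open RealField R
  open Analysis R
  open FieldSolver R
  open OrderedField em R
  open FiniteSums em R
  open Problem 𝒫
  open Costs em 𝒫
  open SOCO 𝒫

  module _ {θ : Carrier} (1≤θ : 1# ≤ θ) (N : Carrier → Carrier) (isNorm-N : IsNorm N) (N1≡ : N 1# ≡ θ * ∥ 1# ∥)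
    (A : Algorithm) (rbg : IsRBG N A) where

    private
      0<θ : 0# < θ
      0<θ = <-≤-trans 0<1 1≤θ

      0≤θ : 0# ≤ θ
      0≤θ = <⇒≤ 0<θ

      ν : Carrier
      ν = ∥ 1# ∥

    competitiveRatio-bound : ∀ {α} → 1# ≤ α → CompetitiveRatioAtMost α A ((1# + θ) ÷ (θ ⊓ α))
    competitiveRatio-bound {α} 1≤α = κ , bound
      where
      μ ρ κ : Carrier
      μ = θ ⊓ α
      ρ = (1# + θ) ÷ μ
      -- The first summand pays for moving the end of the optimal trajectory to `xL`, where the work
      -- function is evaluated, the second for the distance from 0 to the first action.
      κ = (1# + θ) * ν * xH + ν * xH
      0<μ : 0# < μ
      0<μ = <-≤-trans 0<1 (⊓-glb 1≤θ 1≤α)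
      0≤ρ : 0# ≤ ρ
      0≤ρ = *-nonNegative (<⇒≤ (+-positive 0≤1 0<θ)) (⁻¹-nonNegative 0<μ)
      μρ : μ * ρ ≡ 1# + θ
      μρ = trans (solve 3 (λ m t i → m :* (t :* i) := m :* (i :* t)) refl μ (1# + θ) (μ ⁻¹))
            (*-inverse-cancel 0<μ)

      bound : ∀ c → AdmissibleSequence c → ∀ T opt → IsOPT-d α c T opt →
        ∃ λ v → IsExpectedCost 1 1# A c T v × v ≤ ρ * opt + κ
      bound c adm T _ (x , ((x₀≡0 , x∈) , _) , refl) = e , E , *-cancelˡ-≤ EC.0<n goal
        where
        module EC = ExpectedCost em 𝒫 N isNorm-N c adm A rbg
        open EC using (n; w; 0≤n; 0≤ν)
        E = proj₂ (EC.expectedCost-exists 1 T)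
        e = proj₁ (EC.expectedCost-exists 1 T)
        opt C : Carrier
        opt = totalCost α c T x
        C = ∑[ T ] (λ t → c t (x (suc t)) + n * ∣ x (suc t) - x t ∣)

        last-bounds : ∀ T → (∀ t → t ℕ.< T → F (x (suc t))) → 0# ≤ x T × x T ≤ xH
        last-bounds zero    x∈ = ≤-reflexive (sym x₀≡0) , ≤-trans (≤-reflexive x₀≡0) 0≤xH
        last-bounds (suc T) x∈ = F⇒0≤ (x∈ T ℕ.≤-refl) , proj₂ (x∈ T ℕ.≤-refl)

        ∣xL-x∣≤ : ∣ xL - x T ∣ ≤ xH
        ∣xL-x∣≤ = ∣x-y∣-lub
          (linear (xL≤xH ⊕ proj₁ (last-bounds T x∈))
                (solve 3 (λ l h x → h :- (l :- x) := (h :+ x) :- (l :+ :0)) refl xL xH (x T)))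
          (linear (0≤xL ⊕ proj₂ (last-bounds T x∈))
                (solve 3 (λ l h x → h :- (x :- l) := (l :+ h) :- (:0 :+ x)) refl xL xH (x T)))

        w≤ : w T xL ≤ C + n * xH
        w≤ = linear (EC.w-trajectory x T x₀≡0 x∈ (≤-refl , xL≤xH) ⊕ *-monoʳ-≤ 0≤n ∣xL-x∣≤)
          (solve 4 (λ w C d h → (C :+ h) :- w := (C :+ d :+ h) :- (w :+ d)) refl (w T xL) C _ _)

        -- Termwise: `μ ≤ θ` handles the service cost, and `μ ≤ α` the moves, which `C` weights by
        -- `n = θ * ν` and the optimum by `α * ν`.
        μC≤ : μ * C ≤ θ * opt
        μC≤ = ≤-trans (≤-reflexive (sym (∑-*ˡ T μ _)))
              (≤-trans (∑-mono T term) (≤-reflexive (∑-*ˡ T θ _)))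
          where
          term : ∀ t → t ℕ.< T → μ * (c t (x (suc t)) + n * ∣ x (suc t) - x t ∣)
                ≤ θ * (c t (x (suc t)) + α * ∥ x (suc t) - x t ∥)
          term t t<T = linear
            (*-monoˡ-≤ (IsAdmissible.nonNegative (adm t) _ (x∈ t t<T)) (x⊓y≤x θ α)
              ⊕ *-monoˡ-≤ (*-nonNegative 0≤θ
                    (*-nonNegative 0≤ν (0≤∣x∣ {x (suc t) - x t}))) (x⊓y≤y θ α)
              ⊕ ≤-reflexive (cong (λ z → μ * (z * ∣ x (suc t) - x t ∣)) N1≡)
              ⊕ ≤-reflexive (cong (λ z → θ * (α * z)) (sym (EC.∥∥≡ (x (suc t) - x t)))))
            (solve 8 (λ μ θ α c n ν d b → θ :* (c :+ α :* b) :- μ :* (c :+ n :* d) :=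
                (θ :* c :+ (α :* (θ :* (ν :* d)) :+ (μ :* (θ :* ν :* d) :+ θ :* (α :* b)))) :-
                (μ :* c :+ (μ :* (θ :* (ν :* d)) :+ (μ :* (n :* d) :+ θ :* (α :* (ν :* d))))))
              refl μ θ α _ n ν _ _)

        n+ν≡ : n + ν ≡ ν * (1# + θ)
        n+ν≡ = trans (cong (_+ ν) N1≡) (solve 2 (λ θ ν → θ :* ν :+ ν := ν :* (:1 :+ θ)) refl θ ν)

        goal : n * e ≤ n * (ρ * opt + κ)
        goal = linear
          (EC.expectation-bound T E 0≤ν (EC.totalCost₁≤ T) (≤-refl , xL≤xH)
            ⊕ *-monoʳ-≤ (≤-trans 0≤n (linear 0≤ν
                  (solve 2 (λ n ν → n :+ ν :- n := ν :- :0) refl n ν))) w≤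
            ⊕ ≤-reflexive (cong (_* (C + n * xH)) n+ν≡)
            ⊕ ≤-reflexive (cong (λ z → ν * z * C) (sym μρ))
            ⊕ *-monoʳ-≤ (*-nonNegative 0≤ν 0≤ρ) μC≤
            ⊕ ≤-reflexive (cong (λ z → z * (ρ * opt)) (sym N1≡)))
          (solve 11 (λ n e ρ opt θ ν h w C s μ →
              n :* (ρ :* opt :+ ((:1 :+ θ) :* ν :* h :+ ν :* h)) :- n :* e :=
              ((s :* w :+ n :* (ν :* h)) :+ (s :* (C :+ n :* h) :+ (ν :* (:1 :+ θ) :* (C :+ n :* h) :+
                (ν :* (μ :* ρ) :* C :+ (ν :* ρ :* (θ :* opt) :+ n :* (ρ :* opt)))))) :-
              (n :* e :+ (s :* w :+ (s :* (C :+ n :* h) :+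
                (ν :* (:1 :+ θ) :* C :+ (ν :* ρ :* (μ :* C) :+ θ :* ν :* (ρ :* opt)))))))
            refl n e ρ opt θ ν xH (w T xL) C (n + ν) μ)

    -- The summands come from `β * opt / n` with `opt ≤ T B`, from `(n + β) * xH`, and from the
    -- initial move. The value does not involve θ, as it must be fixed before θ.
    regretConstant : Carrier
    regretConstant = (ν ⁻¹ * ((ν + G) * B) + (ν + (ν + G)) * xH) + ν * xH

    regret-bound : RegretAtMost A (λ T → regretConstant * ((fromℕ T ÷ θ) ⊔ θ))
    regret-bound c adm T _ (x , (x∈ , _) , refl) = e , E , *-cancelˡ-≤ EC.0<n goal
      where
      module EC = ExpectedCost em 𝒫 N isNorm-N c adm A rbg
      open EC using (n; w; 0≤n; 0≤ν)
      E = proj₂ (EC.expectedCost-exists 0 T)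
      e = proj₁ (EC.expectedCost-exists 0 T)
      opt β M : Carrier
      opt = ∑[ T ] (λ t → c t x)
      β = ν + G
      M = (fromℕ T ÷ θ) ⊔ θ
      0≤β : 0# ≤ β
      0≤β = linear (0≤ν ⊕ 0≤G (adm 0))
            (solve 2 (λ a b → (a :+ b) :- :0 := (a :+ b) :- (:0 :+ :0)) refl _ _)
      θ≤M : θ ≤ M
      θ≤M = x≤y⊔x _ _
      T≤θM : fromℕ T ≤ θ * M
      T≤θM = ≤-trans
            (≤-reflexive (sym (trans
            (solve 3 (λ a b d → a :* (b :* d) := a :* (d :* b)) refl θ (fromℕ T) (θ ⁻¹))
            (*-inverse-cancel 0<θ))))
        (*-monoʳ-≤ 0≤θ (x≤x⊔y _ _))
      opt≤ : opt ≤ fromℕ T * B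
      opt≤ = ≤-trans (∑-mono T (λ t _ → IsAdmissible.bounded (adm t) x x∈))
            (≤-reflexive (∑-const T B))
      w≤ : w T x ≤ opt + n * xH
      w≤ = ≤-trans (EC.w-static x∈ T) (≤-refl ⊕ *-monoʳ-≤ 0≤n (proj₂ x∈))
      opt-part : β * opt ≤ n * (ν ⁻¹ * (β * B)) * M
      opt-part = ≤-trans (*-monoʳ-≤ 0≤β (≤-trans opt≤ (*-monoˡ-≤ (0≤B (adm 0)) T≤θM)))
        (≤-reflexive (trans
              (solve 4 (λ β θ M B → β :* (θ :* M :* B) := θ :* (β :* B) :* M) refl β θ M B)
          (cong (_* M) (sym (trans (cong (_* (ν ⁻¹ * (β * B))) N1≡)
            (trans (solve 4
                  (λ θ ν i b → θ :* ν :* (i :* b) := θ :* (ν :* (i :* b))) refl θ ν (ν ⁻¹) (β * B))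
              (cong (θ *_) (*-inverse-cancel EC.0<ν))))))))
      n+β≤ : n + β ≤ (ν + β) * M
      n+β≤ = linear (*-monoʳ-≤ 0≤β 1≤θ ⊕ *-monoʳ-≤ 0≤β θ≤M ⊕ *-monoʳ-≤ 0≤ν θ≤M ⊕ ≤-reflexive N1≡)
        (solve 5 (λ n ν β θ M → (ν :+ β) :* M :- (n :+ β) :=
            (β :* θ :+ (β :* M :+ (ν :* M :+ θ :* ν))) :- (β :* :1 :+ (β :* θ :+ (ν :* θ :+ n))))
                  refl n ν β θ M)
      goal : n * (e - opt) ≤ n * (regretConstant * M)
      goal = linear
        (EC.expectation-bound T E 0≤β (EC.totalCost₀≤ T) x∈
          ⊕ *-monoʳ-≤ 0≤n+β w≤ ⊕ opt-part
          ⊕ *-monoˡ-≤ (*-nonNegative 0≤n 0≤xH) n+β≤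
          ⊕ *-monoʳ-≤ (*-nonNegative 0≤n (*-nonNegative 0≤ν 0≤xH)) (≤-trans 1≤θ θ≤M))
        (solve 9 (λ n e opt ν β h M w k →
            n :* (((k :+ (ν :+ β) :* h) :+ ν :* h) :* M) :- n :* (e :- opt) :=
            (((n :+ β) :* w :+ n :* (ν :* h)) :+ ((n :+ β) :* (opt :+ n :* h) :+ (n :* k :* M :+
              ((ν :+ β) :* M :* (n :* h) :+ n :* (ν :* h) :* M)))) :-
            (n :* e :+ ((n :+ β) :* w :+ (β :* opt :+ ((n :+ β) :* (n :* h) :+ n :* (ν :* h) :* :1)))))
          refl n e opt ν β xH M (w T x) (ν ⁻¹ * (β * B)))
        where
        0≤n+β : 0# ≤ n + β
        0≤n+β = linear (0≤n ⊕ 0≤β)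
              (solve 2 (λ a b → (a :+ b) :- :0 := (a :+ b) :- (:0 :+ :0)) refl n β)

theorem4 : ExcludedMiddle 0ℓ → (R : RealField) (𝒫 : Problem R) →
    let open RealField R
        open Analysis R
        open Problem 𝒫
        open SOCO 𝒫
    in
    (∀ θ → 1# ≤ θ → ∀ N → IsNorm N → N 1# ≡ θ * ∥ 1# ∥ →
      ∀ A → IsRBG N A → ∀ α → 1# ≤ α →
      CompetitiveRatioAtMost α A ((1# + θ) ÷ (θ ⊓ α)))
    ×
    (∃ λ K → ∀ θ → 1# ≤ θ → ∀ N → IsNorm N → N 1# ≡ θ * ∥ 1# ∥ →
      ∀ A → IsRBG N A →
      RegretAtMost A (λ T → K * ((fromℕ T ÷ θ) ⊔ θ)))
theorem4 em R 𝒫 =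
  (λ θ 1≤θ N isNorm-N N1≡ A rbg α 1≤α → Bounds.competitiveRatio-bound em 𝒫 1≤θ N isNorm-N N1≡ A rbg 1≤α) ,
  _ , λ θ 1≤θ N isNorm-N N1≡ A rbg → Bounds.regret-bound em 𝒫 1≤θ N isNorm-N N1≡ A rbg
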